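{- For every integer $t\geq 3$ there exists a constant $C$ such that, letting $H_t$ be the subdivision of $K_t$, we have $\mathrm{ex}(n,H_t)\leq Cn^{3/2-1/6^t}$ for all $n$.
   Context: The subdivision of a graph $F$ is the graph obtained from $F$ by replacing each edge by a path of length $2$, the new middle vertices being distinct for distinct edges. $\mathrm{ex}(n,H)$ is the largest number of edges in an $n$-vertex graph containing no copy of $H$. -}

module Defs where

open import Data.Nat using (ℕ; _<ᵇ_)
open import Data.Fin using (Fin; toℕ) renaming (_<_ to _<F_)
open import Data.Bool using (Bool; true; false; _∧_; if_then_else_)
open import Data.List using (List; map; allFin)
open import Data.Nat.ListAction using (sum)
open import Data.Product using (Σ; _×_; _,_; proj₁; proj₂)
open import Data.Sum using (_⊎_; inj₁; inj₂)
open import Data.Empty using (⊥)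
open import Relation.Binary.PropositionalEquality using (_≡_)
open import Function.Definitions using (Injective)

record Graph (n : ℕ) : Set where
  field
    adj    : Fin n → Fin n → Bool
    sym    : ∀ i j → adj i j ≡ adj j i
    irrefl : ∀ i → adj i i ≡ false
open Graph public

edges : ∀ {n} → Graph n → ℕ
edges {n} G =
  sum (map (λ i → sum (map (λ j → if ((toℕ i <ᵇ toℕ j) ∧ adj G i j) then 1 else 0)
                           (allFin n)))
           (allFin n))

record Pattern : Set₁ where
  field
    V   : Set
    Adj : V → V → Set
open Pattern public

Contains : ∀ {n} → Pattern → Graph n → Set
Contains {n} H G =
  Σ (V H → Fin n) λ f → Injective _≡_ _≡_ f × (∀ u v → Adj H u v → adj G (f u) (f v) ≡ true)

EdgeK : ℕ → Set
EdgeK t = Σ (Fin t × Fin t) λ p → proj₁ p <F proj₂ p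

SubdivV : ℕ → Set
SubdivV t = Fin t ⊎ EdgeK t

SubdivAdj : ∀ t → SubdivV t → SubdivV t → Set
SubdivAdj t (inj₁ a) (inj₂ ((i , j) , _)) = (a ≡ i) ⊎ (a ≡ j)
SubdivAdj t (inj₂ ((i , j) , _)) (inj₁ a) = (a ≡ i) ⊎ (a ≡ j)
SubdivAdj t (inj₁ _) (inj₁ _) = ⊥
SubdivAdj t (inj₂ _) (inj₂ _) = ⊥

SubdivK : ℕ → Pattern
SubdivK t = record { V = SubdivV t ; Adj = SubdivAdj t }

{-# OPTIONS --safe #-}
module Submission where

-- Suppose G has at least C n^(3/2 - 1/q) edges, q = 6^t, and let R ≈ n^(1/2q); factors R are
-- affordable losses.  Sorting degrees into classes [R^i , R^(i+1)) and pigeonholing yields vertex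
-- sets A, B such that vertices of A have degree ≥ δ into B, vertices of B have degree ≤ Δ, and
-- |A|, |B|, δ, Δ are related as in an almost regular graph up to powers of R.
--
-- Call a pair of vertices heavy if it has at least t + t² common neighbours in B, and light if it
-- has between 1 and t + t² - 1.  A heavy t-clique extends greedily to a subdivided K_t.  Hence the
-- neighbourhood of each w ∈ B contains no heavy t-clique and so has a positive proportion of light
-- pairs; by Cauchy–Schwarz every large U ⊆ A contains a vertex u that is light to a fraction
-- R^(-13) of U.  Iterating gives nested sets U ⊇ U′ ⊇ ... and a light clique u₁, ..., u_t.  As light
-- pairs have few common neighbours, each of degree ≤ Δ, one can delete at every step the vertices
-- adjacent to a common neighbour of two chosen ones; then the common neighbours of the pairs
-- u_i, u_j are distinct and subdivide K_t.

open import Defs hiding (sym)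
open import Data.Bool using (Bool; true; false; _∧_; _∨_; not; if_then_else_)
import Data.Bool.Properties as Bool
open import Data.Empty using (⊥)
open import Data.Fin using (Fin; zero; suc; toℕ; fromℕ<; combine; remQuot) renaming (_<_ to _<F_)
import Data.Fin.Properties as Fin
import Data.List as List hiding (sum)
import Data.List.Properties as List
open import Data.Nat
import Data.Nat.ListAction as List
open import Data.Nat.Properties
open import Data.Nat.Tactic.RingSolver using (solve-∀)
open import Data.Product using (Σ; ∃-syntax; _×_; _,_; proj₁; proj₂)
open import Data.Sum using (_⊎_; inj₁; inj₂)
open import Data.Vec.Functional using (_∷_)
open import Function using (_∘_)
open import Function.Definitions using (Injective)
open import Relation.Binary using (tri<; tri≈; tri>)
open import Relation.Binary.PropositionalEquality
open import Relation.Nullary using (¬_; Dec; yes; no; does; contradiction; _×-dec_; ¬?)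

open import Algebra.Properties.Semiring.Sum +-*-semiring using (sum; sum-syntax; sum-cong-≗; sum-replicate-zero; ∑-distrib-+; ∑-comm; *-distribˡ-sum; *-distribʳ-sum)

private variable
  n : ℕ
  f g : Fin n → ℕ

-- Finite sums and counting

sum-mono-≤ : (∀ i → f i ≤ g i) → sum f ≤ sum g
sum-mono-≤ {zero}  f≤g = z≤n
sum-mono-≤ {suc n} f≤g = +-mono-≤ (f≤g zero) (sum-mono-≤ (f≤g ∘ suc))

sum-const : ∀ n c → ∑[ i < n ] c ≡ n * c
sum-const zero    c = refl
sum-const (suc n) c = cong (c +_) (sum-const n c)

sum-≤-const : ∀ {c} → (∀ i → f i ≤ c) → sum {n} f ≤ n * c
sum-≤-const {n} {c = c} f≤c = ≤-trans (sum-mono-≤ f≤c) (≤-reflexive (sum-const n c))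

term≤sum : ∀ (f : Fin n → ℕ) i → f i ≤ sum f
term≤sum f zero    = m≤m+n _ _
term≤sum f (suc i) = ≤-trans (term≤sum (f ∘ suc) i) (m≤n+m _ (f zero))

sum≡0⇒term≡0 : ∀ (f : Fin n → ℕ) → sum f ≡ 0 → ∀ i → f i ≡ 0
sum≡0⇒term≡0 f eq i = n≤0⇒n≡0 (subst (f i ≤_) eq (term≤sum f i))

sum-positive : ∀ (f : Fin n → ℕ) → 0 < sum f → ∃[ i ] 0 < f i
sum-positive {suc n} f pos with f zero in eq
... | suc k = zero , subst (0 <_) (sym eq) z<s
... | zero with i , p ← sum-positive (f ∘ suc) pos = suc i , p

ind : Bool → ℕ
ind true  = 1
ind false = 0

ind≤1 : ∀ b → ind b ≤ 1
ind≤1 true  = ≤-refl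
ind≤1 false = z≤n

ind-∧ : ∀ a b → ind (a ∧ b) ≡ ind a * ind b
ind-∧ true  b = sym (+-identityʳ (ind b))
ind-∧ false b = refl

ind>0⇒true : ∀ b → 0 < ind b → b ≡ true
ind>0⇒true true _ = refl

∧-trueˡ : ∀ a {b} → a ∧ b ≡ true → a ≡ true
∧-trueˡ true _ = refl

∧-trueʳ : ∀ a {b} → a ∧ b ≡ true → b ≡ true
∧-trueʳ true eq = eq

does-true⇒ : ∀ {p} {P : Set p} (P? : Dec P) → does P? ≡ true → P
does-true⇒ (yes p) _ = p

does-false⇒ : ∀ {p} {P : Set p} (P? : Dec P) → does P? ≡ false → ¬ P
does-false⇒ (no ¬p) _ = ¬p

⇒does-true : ∀ {p} {P : Set p} (P? : Dec P) → P → does P? ≡ true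
⇒does-true (yes _) _ = refl
⇒does-true (no ¬p) p = contradiction p ¬p

⇒does-false : ∀ {p} {P : Set p} (P? : Dec P) → ¬ P → does P? ≡ false
⇒does-false (yes p) ¬p = contradiction p ¬p
⇒does-false (no _)  _  = refl

count : (Fin n → Bool) → ℕ
count U = sum (ind ∘ U)

count-positive : (U : Fin n → Bool) → 0 < count U → ∃[ v ] U v ≡ true
count-positive U pos with v , p ← sum-positive (ind ∘ U) pos = v , ind>0⇒true (U v) p

count≤n : (U : Fin n → Bool) → count U ≤ n
count≤n {n} U = ≤-trans (sum-≤-const (λ i → ind≤1 (U i))) (≤-reflexive (*-identityʳ n))

weighted-sum-≤ : ∀ (U : Fin n → Bool) {c} → (∀ v → U v ≡ true → f v ≤ c) →
                 ∑[ v < n ] (ind (U v) * f v) ≤ count U * c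
weighted-sum-≤ {n} {f} U {c} f≤c = ≤-trans (sum-mono-≤ pointwise) (≤-reflexive (sym (*-distribʳ-sum c (ind ∘ U))))
  where
  pointwise : ∀ v → ind (U v) * f v ≤ ind (U v) * c
  pointwise v with U v in eq
  ... | true  = *-monoʳ-≤ 1 (f≤c v eq)
  ... | false = z≤n

weighted-sum-≥ : ∀ (U : Fin n → Bool) {c} → (∀ v → U v ≡ true → c ≤ f v) →
                 count U * c ≤ ∑[ v < n ] (ind (U v) * f v)
weighted-sum-≥ {n} {f} U {c} f≥c = ≤-trans (≤-reflexive (*-distribʳ-sum c (ind ∘ U))) (sum-mono-≤ pointwise)
  where
  pointwise : ∀ v → ind (U v) * c ≤ ind (U v) * f v
  pointwise v with U v in eq
  ... | true  = *-monoʳ-≤ 1 (f≥c v eq)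
  ... | false = z≤n

sum-select : ∀ (x : Fin n) (g : Fin n → ℕ) → ∑[ w < n ] (ind (does (x Fin.≟ w)) * g w) ≡ g x
sum-select {suc n} zero    g =
  trans (cong (1 * g zero +_) (sum-replicate-zero n)) (trans (+-identityʳ _) (+-identityʳ _))
sum-select {suc n} (suc x) g = sum-select x (g ∘ suc)

-- The two sides differ by the square of k, the gap between x and y; writing the larger number as
-- the smaller plus k avoids subtraction.
am-gm : ∀ x y → 2 * (x * y) ≤ x * x + y * y
am-gm x y with ≤-total x y
... | inj₁ x≤y with k , refl ← m≤n⇒∃[o]m+o≡n x≤y =
  subst (2 * (x * (x + k)) ≤_) (id₁ x k) (m≤m+n _ _)
  where
  id₁ : ∀ x k → 2 * (x * (x + k)) + k * k ≡ x * x + (x + k) * (x + k)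
  id₁ = solve-∀
... | inj₂ y≤x with k , refl ← m≤n⇒∃[o]m+o≡n y≤x =
  subst (2 * ((y + k) * y) ≤_) (id₂ y k) (m≤m+n _ _)
  where
  id₂ : ∀ y k → 2 * ((y + k) * y) + k * k ≡ (y + k) * (y + k) + y * y
  id₂ = solve-∀

-- Summing 2(b s)σ ≤ (b s)² + σ² over the support, where b is its size and σ the sum.
cauchy-schwarz : ∀ (B : Fin n → Bool) (s : Fin n → ℕ) → (∀ w → B w ≡ false → s w ≡ 0) →
                 sum s * sum s ≤ count B * ∑[ w < n ] (s w * s w)
cauchy-schwarz {n} B s s-supp with count B in eqb
... | zero = ≤-reflexive (cong (λ z → z * z) σ≡0)
  where
  σ≡0 : sum s ≡ 0
  σ≡0 = trans (sum-cong-≗ λ w → s-supp w (notin w)) (sum-replicate-zero n)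
    where
    notin : ∀ w → B w ≡ false
    notin w with B w | sum≡0⇒term≡0 (ind ∘ B) eqb w
    ... | false | _ = refl
... | b@(suc b-1) = *-cancelˡ-≤ b (+-cancelʳ-≤ (b * (σ * σ)) _ _ (begin
  b * (σ * σ) + b * (σ * σ)                          ≡⟨ shape b σ ⟩
  2 * (b * σ) * σ                                      ≡⟨ *-distribˡ-sum (2 * (b * σ)) s ⟩
  ∑[ w < n ] (2 * (b * σ) * s w)                     ≤⟨ sum-mono-≤ pointwise ⟩
  ∑[ w < n ] (b * b * (s w * s w) + ind (B w) * (σ * σ))
    ≡⟨ ∑-distrib-+ (λ w → b * b * (s w * s w)) (λ w → ind (B w) * (σ * σ)) ⟩
  ∑[ w < n ] (b * b * (s w * s w)) + ∑[ w < n ] (ind (B w) * (σ * σ))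
    ≡⟨ cong₂ _+_ (sym (*-distribˡ-sum (b * b) (λ w → s w * s w))) (sym (*-distribʳ-sum (σ * σ) (ind ∘ B))) ⟩
  b * b * Q + count B * (σ * σ)                      ≡⟨ cong₂ _+_ (*-assoc b b Q) (cong (_* (σ * σ)) eqb) ⟩
  b * (b * Q) + b * (σ * σ)                          ∎))
  where
  open ≤-Reasoning
  σ = sum s
  Q = ∑[ w < n ] (s w * s w)
  shape : ∀ b σ → b * (σ * σ) + b * (σ * σ) ≡ 2 * (b * σ) * σ
  shape = solve-∀
  regroup₁ : ∀ b σ x → 2 * (b * σ) * x ≡ 2 * ((b * x) * σ)
  regroup₁ = solve-∀
  regroup₂ : ∀ b σ x → (b * x) * (b * x) + σ * σ ≡ b * b * (x * x) + 1 * (σ * σ)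
  regroup₂ = solve-∀
  pointwise : ∀ w → 2 * (b * σ) * s w ≤ b * b * (s w * s w) + ind (B w) * (σ * σ)
  pointwise w with B w in eqw
  ... | true  = ≤-trans (≤-reflexive (regroup₁ b σ (s w)))
                  (≤-trans (am-gm (b * s w) σ) (≤-reflexive (regroup₂ b σ (s w))))
  ... | false rewrite s-supp w eqw = ≤-trans (≤-reflexive (*-zeroʳ (2 * (b * σ)))) z≤n

-- Embedding subdivisions

-- If every element of `P` were some `x j`, the k singletons would cover `P`, and exchanging the two
-- sums would give count P ≤ k.
avoiding-element : ∀ {k} (P : Fin n → Bool) (x : Fin k → Fin n) → k < count P →
                   ∃[ v ] P v ≡ true × (∀ j → v ≢ x j)
avoiding-element {n} {k} P x k<P
  with Fin.any? (λ v → (P v Bool.≟ true) ×-dec Fin.all? (λ j → ¬? (v Fin.≟ x j)))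
... | yes found = found
... | no ¬found = contradiction k<P (≤⇒≯ (begin
  count P                                              ≤⟨ sum-mono-≤ covered ⟩
  ∑[ v < n ] ∑[ j < k ] (ind (does (x j Fin.≟ v)) * 1) ≡⟨ ∑-comm (λ v j → ind (does (x j Fin.≟ v)) * 1) ⟩
  ∑[ j < k ] ∑[ v < n ] (ind (does (x j Fin.≟ v)) * 1) ≤⟨ sum-≤-const (λ j → ≤-reflexive (sum-select (x j) (λ _ → 1))) ⟩
  k * 1                                                ≡⟨ *-identityʳ k ⟩
  k                                                    ∎))
  where
  open ≤-Reasoning
  covered : ∀ v → ind (P v) ≤ ∑[ j < k ] (ind (does (x j Fin.≟ v)) * 1)
  covered v with P v in eq
  ... | false = z≤n
  ... | true with Fin.any? (λ j → x j Fin.≟ v)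
  ...   | yes (j , xj≡v) = ≤-trans (≤-reflexive (sym (cong (λ b → ind b * 1) (⇒does-true (x j Fin.≟ v) xj≡v))))
                                   (term≤sum (λ j → ind (does (x j Fin.≟ v)) * 1) j)
  ...   | no ¬hit = contradiction (v , eq , λ j v≡xj → ¬hit (j , sym v≡xj)) ¬found

-- Greedy choice: the vertex picked for the first set joins the forbidden list `x`, so k grows as m
-- drops and k + m keeps its value.
distinct-representatives : ∀ m {k} (P : Fin m → Fin n → Bool) (x : Fin k → Fin n) →
  (∀ i → k + m ≤ count (P i)) →
  ∃[ w ] Injective {A = Fin m} _≡_ _≡_ w × (∀ i → P i (w i) ≡ true) × (∀ i j → w i ≢ x j)
distinct-representatives zero    P x large = (λ ()) , (λ { {()} }) , (λ ()) , (λ ())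
distinct-representatives {n} (suc m) {k} P x large
  with v , Pv , v∉x ← avoiding-element (P zero) x
         (≤-trans (≤-trans (s≤s (m≤m+n k m)) (≤-reflexive (sym (+-suc k m)))) (large zero))
  with w , w-inj , Pw , w∉ ← distinct-representatives m (P ∘ suc) (v ∷ x)
         (λ i → ≤-trans (≤-reflexive (sym (+-suc k m))) (large (suc i)))
  = v ∷ w , inj , sat , avoid
  where
  inj : Injective _≡_ _≡_ (v ∷ w)
  inj {zero}  {zero}  _  = refl
  inj {zero}  {suc j} eq = contradiction (sym eq) (w∉ j zero)
  inj {suc i} {zero}  eq = contradiction eq (w∉ i zero)
  inj {suc i} {suc j} eq = cong suc (w-inj eq)
  sat : ∀ i → P i ((v ∷ w) i) ≡ true
  sat zero    = Pv
  sat (suc i) = Pw i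
  avoid : ∀ i j → (v ∷ w) i ≢ x j
  avoid zero    j = v∉x j
  avoid (suc i) j = w∉ i (suc j)

subdivision-embedding : ∀ {t} (G : Graph n) (u : Fin t → Fin n) (w : EdgeK t → Fin n) →
  Injective _≡_ _≡_ u → Injective _≡_ _≡_ w → (∀ e k → w e ≢ u k) →
  (∀ e → adj G (u (proj₁ (proj₁ e))) (w e) ≡ true × adj G (u (proj₂ (proj₁ e))) (w e) ≡ true) →
  Contains (SubdivK t) G
subdivision-embedding {n} {t} G u w u-inj w-inj w≢u adjacent = φ , φ-inj , φ-adj
  where
  φ : SubdivV t → Fin n
  φ (inj₁ i) = u i
  φ (inj₂ e) = w e
  φ-inj : Injective _≡_ _≡_ φ
  φ-inj {inj₁ i} {inj₁ j} eq = cong inj₁ (u-inj eq)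
  φ-inj {inj₁ i} {inj₂ e} eq = contradiction (sym eq) (w≢u e i)
  φ-inj {inj₂ e} {inj₁ i} eq = contradiction eq (w≢u e i)
  φ-inj {inj₂ d} {inj₂ e} eq = cong inj₂ (w-inj eq)
  φ-adj : ∀ x y → SubdivAdj t x y → adj G (φ x) (φ y) ≡ true
  φ-adj (inj₁ a) (inj₂ e) (inj₁ refl) = proj₁ (adjacent e)
  φ-adj (inj₁ a) (inj₂ e) (inj₂ refl) = proj₂ (adjacent e)
  φ-adj (inj₂ e) (inj₁ a) (inj₁ refl) = trans (Graph.sym G _ _) (proj₁ (adjacent e))
  φ-adj (inj₂ e) (inj₁ a) (inj₂ refl) = trans (Graph.sym G _ _) (proj₂ (adjacent e))

EdgeK-≡ : ∀ {t} {d e : EdgeK t} → proj₁ (proj₁ d) ≡ proj₁ (proj₁ e) → proj₂ (proj₁ d) ≡ proj₂ (proj₁ e) → d ≡ e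
EdgeK-≡ {d = (i , j) , p} {e = (i , j) , p′} refl refl = cong ((i , j) ,_) (≤-irrelevant p p′)

codegree : (Fin n → Fin n → Bool) → Fin n → Fin n → ℕ
codegree {n} E u v = ∑[ w < n ] (ind (E u w) * ind (E v w))

-- Room for avoiding t branch vertices while choosing t * t distinct middle vertices.
heavyBound : ℕ → ℕ
heavyBound t = t + t * t

-- Representatives are chosen for all t * t ordered pairs at once, so that `combine` indexes them;
-- the pairs with i < j then supply the middle vertices.
heavy-clique⇒subdivision : ∀ {t} (G : Graph n) (E : Fin n → Fin n → Bool) →
  (∀ u w → E u w ≡ true → adj G u w ≡ true) →
  (u : Fin t → Fin n) → Injective _≡_ _≡_ u →
  (∀ i j → heavyBound t ≤ codegree E (u i) (u j)) →
  Contains (SubdivK t) G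
heavy-clique⇒subdivision {n} {t} G E E⊆G u u-inj heavy =
  subdivision-embedding G u edgeVertex u-inj edge-inj (λ _ k → w∉u _ k) adjacent
  where
  common : Fin t × Fin t → Fin n → Bool
  common (i , j) v = E (u i) v ∧ E (u j) v
  large : ∀ p → t + t * t ≤ count (common p)
  large (i , j) =
    ≤-trans (heavy i j) (≤-reflexive (sum-cong-≗ {n} (λ v → sym (ind-∧ (E (u i) v) (E (u j) v)))))
  representatives = distinct-representatives (t * t) (common ∘ remQuot {t} t) u (λ x → large (remQuot {t} t x))
  w     = proj₁ representatives
  w-inj = proj₁ (proj₂ representatives)
  Pw    = proj₁ (proj₂ (proj₂ representatives))
  w∉u   = proj₂ (proj₂ (proj₂ representatives))
  edgeVertex : EdgeK t → Fin n
  edgeVertex ((i , j) , _) = w (combine i j)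
  edge-inj : Injective _≡_ _≡_ edgeVertex
  edge-inj {(i , j) , _} {(k , l) , _} eq with i≡k , j≡l ← Fin.combine-injective i j k l (w-inj eq) = EdgeK-≡ i≡k j≡l
  adjacent : ∀ e → adj G (u (proj₁ (proj₁ e))) (edgeVertex e) ≡ true × adj G (u (proj₂ (proj₁ e))) (edgeVertex e) ≡ true
  adjacent ((i , j) , _) = E⊆G _ _ (∧-trueˡ (E (u i) _) eq) , E⊆G _ _ (∧-trueʳ (E (u i) _) eq)
    where
    eq : common (i , j) (w (combine i j)) ≡ true
    eq = subst (λ p → common p (w (combine i j)) ≡ true) (Fin.remQuot-combine i j) (Pw (combine i j))

-- With the loops added, Disjointed rules out not only that two middle vertices coincide but also
-- that a middle vertex is a branch vertex.  Only the vanishing of the value matters.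
reflexive : (Fin n → Fin n → Bool) → Fin n → Fin n → ℕ
reflexive E u w = ind (does (u Fin.≟ w)) + ind (E u w)

Disjointed : (Fin n → Fin n → Bool) → Fin n → Fin n → Fin n → Set
Disjointed E x y z = ∀ w → reflexive E x w * (reflexive E y w * reflexive E z w) ≡ 0

private
  reflexive>0ˡ : ∀ (E : Fin n → Fin n → Bool) u → 0 < reflexive E u u
  reflexive>0ˡ E u rewrite ⇒does-true (u Fin.≟ u) refl = z<s

  reflexive>0ʳ : ∀ (E : Fin n → Fin n → Bool) u w → E u w ≡ true → 0 < reflexive E u w
  reflexive>0ʳ E u w eq rewrite eq = m≤n+m 1 (ind (does (u Fin.≟ w)))

light-clique⇒subdivision : ∀ {t} (G : Graph n) (E : Fin n → Fin n → Bool) →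
  (∀ u w → E u w ≡ true → adj G u w ≡ true) →
  (u : Fin t → Fin n) → (∀ {i j} → i <F j → u i ≢ u j) →
  (∀ {i j} → i <F j → ∃[ w ] E (u i) w ≡ true × E (u j) w ≡ true) →
  (∀ {i j k} → i ≢ j → i ≢ k → j ≢ k → Disjointed E (u i) (u j) (u k)) →
  Contains (SubdivK t) G
light-clique⇒subdivision {n} {t} G E E⊆G u distinct linked disj =
  subdivision-embedding G u w u-inj w-inj w≢u
    (λ (_ , i<j) → let _ , p , q = linked i<j in E⊆G _ _ p , E⊆G _ _ q)
  where
  w : EdgeK t → Fin n
  w (_ , i<j) = proj₁ (linked i<j)
  u-inj : Injective _≡_ _≡_ u
  u-inj {i} {j} eq with Fin.<-cmp i j
  ... | tri< i<j _ _ = contradiction eq (distinct i<j)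
  ... | tri≈ _ i≡j _ = i≡j
  ... | tri> _ _ j<i = contradiction (sym eq) (distinct j<i)
  -- A middle vertex equal or adjacent to a branch vertex outside its own edge would make the
  -- product in `Disjointed` positive.
  third : ∀ (e : EdgeK t) k → 0 < reflexive E (u k) (w e) → (proj₁ (proj₁ e) ≡ k) ⊎ (proj₂ (proj₁ e) ≡ k)
  third ((i , j) , i<j) k pos with i Fin.≟ k | j Fin.≟ k
  ... | yes eq | _      = inj₁ eq
  ... | no _   | yes eq = inj₂ eq
  ... | no i≢k | no j≢k with v , p , q ← linked i<j =
    contradiction (disj (Fin.<⇒≢ i<j) i≢k j≢k v)
      (m<n⇒n≢0 (*-mono-< (reflexive>0ʳ E (u i) v p) (*-mono-< (reflexive>0ʳ E (u j) v q) pos)))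
  -- If `w e` were `u k`, then k would be an endpoint of e by `third`, and `u k` would be adjacent
  -- to itself.
  w≢u : ∀ e k → w e ≢ u k
  w≢u e@((i , j) , i<j) k eq with third e k (subst (λ z → 0 < reflexive E (u k) z) (sym eq) (reflexive>0ˡ E (u k)))
  ... | inj₁ refl = contradiction (trans (sym (E⊆G _ _ (proj₁ (proj₂ (linked i<j)))))
                      (trans (cong (adj G (u i)) eq) (irrefl G (u i)))) λ ()
  ... | inj₂ refl = contradiction (trans (sym (E⊆G _ _ (proj₂ (proj₂ (linked i<j)))))
                      (trans (cong (adj G (u j)) eq) (irrefl G (u j)))) λ ()
  w-inj : Injective _≡_ _≡_ w
  -- By `third` both endpoints of e are endpoints of d; the orders i < j and k < l leave only the
  -- matching i = k, j = l.
  w-inj {d@((i , j) , i<j)} {e@((k , l) , k<l)} eq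
    with third d k (subst (λ z → 0 < reflexive E (u k) z) (sym eq) (reflexive>0ʳ E (u k) (w e) (proj₁ (proj₂ (linked k<l)))))
       | third d l (subst (λ z → 0 < reflexive E (u l) z) (sym eq) (reflexive>0ʳ E (u l) (w e) (proj₂ (proj₂ (linked k<l)))))
  ... | inj₁ i≡k | inj₂ j≡l = EdgeK-≡ i≡k j≡l
  ... | inj₁ refl | inj₁ refl = contradiction k<l (<-irrefl refl)
  ... | inj₂ refl | inj₂ refl = contradiction k<l (<-irrefl refl)
  ... | inj₂ refl | inj₁ refl = contradiction k<l (<-asym i<j)

-- Density of light pairs

IndependentIn : (Fin n → Fin n → Bool) → (Fin n → Bool) → ℕ → Set
IndependentIn {n} L W j = Σ (Fin j → Fin n) λ us →
  (∀ i → W (us i) ≡ true) × (∀ {i k} → i <F k → L (us i) (us k) ≡ false)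

-- Greedy choice with invariant j |Q| ≤ t |W|: picking u and discarding its L-neighbours costs at
-- most |Q| / t elements of W, which lowers j by one.
independent-set : ∀ t (L : Fin n → Fin n → Bool) (Q : Fin n → Bool) → 0 < count Q →
  (∀ u → Q u ≡ true → t * ∑[ v < n ] (ind (Q v) * ind (L u v)) ≤ count Q) →
  ∀ j (W : Fin n → Bool) → (∀ v → W v ≡ true → Q v ≡ true) → j * count Q ≤ t * count W →
  IndependentIn L W j
independent-set t L Q Q>0 sparse zero    W W⊆Q large = (λ ()) , (λ ()) , (λ { {()} })
independent-set {n} t L Q Q>0 sparse (suc j) W W⊆Q large = extend (count-positive W W>0)
  where
  W>0 : 0 < count W
  W>0 with count W
  ... | suc _ = z<s
  ... | zero  = contradiction (≤-trans Q>0 (≤-trans (m≤m+n _ _) large)) (≤⇒≯ (≤-reflexive (*-zeroʳ t)))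
  rest : Fin n → Fin n → Bool
  rest u v = W v ∧ not (L u v)
  split : ∀ u v → ind (W v) ≤ ind (rest u v) + ind (Q v) * ind (L u v)
  split u v with W v in eqW | L u v
  ... | false | _     = z≤n
  ... | true  | false = s≤s z≤n
  ... | true  | true  rewrite W⊆Q v eqW = ≤-refl
  large′ : ∀ u → Q u ≡ true → j * count Q ≤ t * count (rest u)
  large′ u Qu = +-cancelˡ-≤ (count Q) _ _ (begin
    count Q + j * count Q   ≤⟨ large ⟩
    t * count W             ≤⟨ *-monoʳ-≤ t (sum-mono-≤ (split u)) ⟩
    t * ∑[ v < n ] (ind (rest u v) + ind (Q v) * ind (L u v))
      ≡⟨ cong (t *_) (∑-distrib-+ (ind ∘ rest u) (λ v → ind (Q v) * ind (L u v))) ⟩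
    t * (count (rest u) + ∑[ v < n ] (ind (Q v) * ind (L u v)))
      ≡⟨ *-distribˡ-+ t (count (rest u)) _ ⟩
    t * count (rest u) + t * ∑[ v < n ] (ind (Q v) * ind (L u v))
      ≤⟨ +-monoʳ-≤ _ (sparse u Qu) ⟩
    t * count (rest u) + count Q
      ≡⟨ +-comm _ (count Q) ⟩
    count Q + t * count (rest u) ∎)
    where open ≤-Reasoning
  extend : ∃[ u ] W u ≡ true →
    IndependentIn L W (suc j)
  extend (u , Wu) with us , us∈ , us-ind ← independent-set t L Q Q>0 sparse j (rest u)
                         (λ v eq → W⊆Q v (∧-trueˡ (W v) eq)) (large′ u (W⊆Q u Wu))
    = u ∷ us , mem , pairs
    where
    mem : ∀ i → W ((u ∷ us) i) ≡ true
    mem zero    = Wu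
    mem (suc i) = ∧-trueˡ (W (us i)) (us∈ i)
    not-true⇒false : ∀ {b} → not b ≡ true → b ≡ false
    not-true⇒false {false} _ = refl
    pairs : ∀ {i k} → i <F k → L ((u ∷ us) i) ((u ∷ us) k) ≡ false
    pairs {zero}  {suc k} _         = not-true⇒false (∧-trueʳ (W (us k)) (us∈ k))
    pairs {suc i} {suc k} (s<s i<k) = us-ind i<k

-- Either at least half of the vertices have L-degree at least s/2t inside S, or the remaining
-- ones contain an L-independent t-set, found greedily.
dense-if-no-independent-set : ∀ t (L : Fin n → Fin n → Bool) (S : Fin n → Bool) →
  ¬ IndependentIn L S t →
  count S * count S ≤ 4 * t * ∑[ u < n ] (ind (S u) * ∑[ v < n ] (ind (S v) * ind (L u v)))
dense-if-no-independent-set {n} t L S none = case-on (s ≤? 2 * count P)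
  where
  open ≤-Reasoning
  s = count S
  ld : Fin n → ℕ
  ld u = ∑[ v < n ] (ind (S v) * ind (L u v))
  P Q : Fin n → Bool
  P u = S u ∧ does (s ≤? 2 * t * ld u)
  Q u = S u ∧ not (does (s ≤? 2 * t * ld u))
  P+Q : s ≡ count P + count Q
  P+Q = trans (sum-cong-≗ {n} pointwise) (∑-distrib-+ (ind ∘ P) (ind ∘ Q))
    where
    pointwise : ∀ u → ind (S u) ≡ ind (P u) + ind (Q u)
    pointwise u with S u | does (s ≤? 2 * t * ld u)
    ... | false | _     = refl
    ... | true  | true  = refl
    ... | true  | false = refl
  Q⊆S : ∀ v → Q v ≡ true → S v ≡ true
  Q⊆S v = ∧-trueˡ (S v)
  regroup₁ : ∀ p s → 2 * p * s ≡ 2 * (p * s)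
  regroup₁ = solve-∀
  regroup₂ : ∀ t x → 2 * (2 * t * x) ≡ 4 * t * x
  regroup₂ = solve-∀
  P-large : ∀ u → ind (P u) * s ≤ 2 * t * (ind (S u) * ld u)
  P-large u with S u | does (s ≤? 2 * t * ld u) in eq
  ... | false | _     = z≤n
  ... | true  | false = z≤n
  ... | true  | true  = ≤-trans (≤-reflexive (*-identityˡ s)) (≤-trans (does-true⇒ (s ≤? 2 * t * ld u) eq) (≤-reflexive (cong (2 * t *_) (sym (*-identityˡ (ld u))))))
  Q-sparse : s < 2 * count Q → ∀ u → Q u ≡ true → t * ∑[ v < n ] (ind (Q v) * ind (L u v)) ≤ count Q
  Q-sparse s<2Q u Qu with S u | does (s ≤? 2 * t * ld u) in eq
  ... | true | false = *-cancelˡ-≤ 2 (begin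
    2 * (t * ∑[ v < n ] (ind (Q v) * ind (L u v))) ≤⟨ *-monoʳ-≤ 2 (*-monoʳ-≤ t (sum-mono-≤ (λ v → *-monoˡ-≤ (ind (L u v)) (ind-mono v)))) ⟩
    2 * (t * ld u)                                 ≡⟨ sym (*-assoc 2 t (ld u)) ⟩
    2 * t * ld u                                   ≤⟨ <⇒≤ (≰⇒> (does-false⇒ (s ≤? 2 * t * ld u) eq)) ⟩
    s                                              ≤⟨ <⇒≤ s<2Q ⟩
    2 * count Q                                    ∎)
    where
    ind-mono : ∀ v → ind (Q v) ≤ ind (S v)
    ind-mono v with S v
    ... | false = z≤n
    ... | true  = ind≤1 _
  case-on : Dec (s ≤ 2 * count P) → s * s ≤ 4 * t * ∑[ u < n ] (ind (S u) * ld u)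
  case-on (yes s≤2P) = begin
    s * s                                             ≤⟨ *-monoˡ-≤ s s≤2P ⟩
    2 * count P * s                                   ≡⟨ regroup₁ (count P) s ⟩
    2 * (count P * s)                                 ≡⟨ cong (2 *_) (*-distribʳ-sum s (ind ∘ P)) ⟩
    2 * ∑[ u < n ] (ind (P u) * s)                    ≤⟨ *-monoʳ-≤ 2 (sum-mono-≤ P-large) ⟩
    2 * ∑[ u < n ] (2 * t * (ind (S u) * ld u))       ≡⟨ cong (2 *_) (sym (*-distribˡ-sum (2 * t) (λ u → ind (S u) * ld u))) ⟩
    2 * (2 * t * ∑[ u < n ] (ind (S u) * ld u))       ≡⟨ regroup₂ t _ ⟩
    4 * t * ∑[ u < n ] (ind (S u) * ld u)             ∎
  case-on (no s≰2P) = contradiction found none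
    where
    s<2Q : s < 2 * count Q
    s<2Q = +-cancelʳ-< s _ _ (begin-strict
      s + s                       ≡⟨ cong (s +_) (sym (+-identityʳ s)) ⟩
      2 * s                       ≡⟨ cong (2 *_) P+Q ⟩
      2 * (count P + count Q)     ≡⟨ *-distribˡ-+ 2 (count P) (count Q) ⟩
      2 * count P + 2 * count Q   <⟨ +-monoˡ-< (2 * count Q) (≰⇒> s≰2P) ⟩
      s + 2 * count Q             ≡⟨ +-comm s _ ⟩
      2 * count Q + s             ∎)
    Q>0 : 0 < count Q
    Q>0 with count Q | s<2Q
    ... | suc _ | _ = z<s
    found : IndependentIn L S t
    found with us , us∈ , us-ind ← independent-set t L Q Q>0 (Q-sparse s<2Q) t Q (λ _ eq → eq) ≤-refl
      = us , (λ i → Q⊆S (us i) (us∈ i)) , us-ind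

codegree-sym : ∀ (E : Fin n → Fin n → Bool) u v → codegree E u v ≡ codegree E v u
codegree-sym {n} E u v = sum-cong-≗ {n} (λ w → *-comm (ind (E u w)) (ind (E v w)))

degree : (Fin n → Fin n → Bool) → Fin n → ℕ
degree E u = count (E u)

codegree-self : ∀ (E : Fin n → Fin n → Bool) u → codegree E u u ≡ degree E u
codegree-self {n} E u = sum-cong-≗ {n} (λ w → idem (E u w))
  where
  idem : ∀ b → ind b * ind b ≡ ind b
  idem true  = refl
  idem false = refl

-- Containing the diagonal makes the members of an independent set distinct, so that such a set is a
-- heavy clique.
nonHeavy : (Fin n → Fin n → Bool) → ℕ → Fin n → Fin n → Bool
nonHeavy E t u v = does (u Fin.≟ v) ∨ does (codegree E u v <? heavyBound t)

light : (Fin n → Fin n → Bool) → ℕ → Fin n → Fin n → Bool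
light E t u v = not (does (u Fin.≟ v)) ∧ (does (0 <? codegree E u v) ∧ does (codegree E u v <? heavyBound t))

lightDegree : (Fin n → Fin n → Bool) → ℕ → (Fin n → Bool) → Fin n → ℕ
lightDegree {n} E t U u = ∑[ v < n ] (ind (U v) * ind (light E t u v))

no-heavy-clique : ∀ {t} (G : Graph n) → ¬ Contains (SubdivK t) G →
  ∀ (E : Fin n → Fin n → Bool) → (∀ u w → E u w ≡ true → adj G u w ≡ true) →
  ∀ (S : Fin n → Bool) → (∀ u → S u ≡ true → heavyBound t ≤ degree E u) →
  ¬ IndependentIn (nonHeavy E t) S t
no-heavy-clique {n} {t} G free E E⊆G S S-deg (us , us∈S , pairs) =
  free (heavy-clique⇒subdivision G E E⊆G us inj heavy)
  where
  split : ∀ a {b} → a ∨ b ≡ false → a ≡ false × b ≡ false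
  split false eq = refl , eq
  apart : ∀ {i k} → i <F k → us i ≢ us k
  apart {i} {k} i<k = does-false⇒ (us i Fin.≟ us k) (proj₁ (split (does (us i Fin.≟ us k)) (pairs i<k)))
  big : ∀ {i k} → i <F k → heavyBound t ≤ codegree E (us i) (us k)
  big {i} {k} i<k = ≮⇒≥ (does-false⇒ (codegree E (us i) (us k) <? heavyBound t)
                           (proj₂ (split (does (us i Fin.≟ us k)) (pairs i<k))))
  inj : Injective _≡_ _≡_ us
  inj {i} {k} eq with Fin.<-cmp i k
  ... | tri< i<k _ _ = contradiction eq (apart i<k)
  ... | tri≈ _ i≡k _ = i≡k
  ... | tri> _ _ k<i = contradiction (sym eq) (apart k<i)
  heavy : ∀ i k → heavyBound t ≤ codegree E (us i) (us k)
  heavy i k with Fin.<-cmp i k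
  ... | tri< i<k _ _  = big i<k
  -- On the diagonal the codegree is the degree, and the degree bound on `S` takes over.
  ... | tri≈ _ refl _ = ≤-trans (S-deg (us i) (us∈S i)) (≤-reflexive (sym (codegree-self E (us i))))
  ... | tri> _ _ k<i  = ≤-trans (big k<i) (≤-reflexive (codegree-sym E (us k) (us i)))

-- A non-heavy pair is diagonal and contributes the degree of u, or has codegree 0 and contributes
-- nothing, or is light and contributes less than `heavyBound t`.
nonHeavy-codegree-sum : ∀ (E : Fin n → Fin n → Bool) t (U : Fin n → Bool) u →
  ∑[ v < n ] (ind (U v) * ind (nonHeavy E t u v) * codegree E u v) ≤ degree E u + heavyBound t * lightDegree E t U u
nonHeavy-codegree-sum {n} E t U u = begin
  ∑[ v < n ] (ind (U v) * ind (nonHeavy E t u v) * cod v)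
    ≤⟨ sum-mono-≤ pointwise ⟩
  ∑[ v < n ] (ind (does (u Fin.≟ v)) * cod v + T * (ind (U v) * ind (light E t u v)))
    ≡⟨ ∑-distrib-+ (λ v → ind (does (u Fin.≟ v)) * cod v) (λ v → T * (ind (U v) * ind (light E t u v))) ⟩
  ∑[ v < n ] (ind (does (u Fin.≟ v)) * cod v) + ∑[ v < n ] (T * (ind (U v) * ind (light E t u v)))
    ≡⟨ cong₂ _+_ (trans (sum-select u cod) (codegree-self E u)) (sym (*-distribˡ-sum T (λ v → ind (U v) * ind (light E t u v)))) ⟩
  degree E u + T * lightDegree E t U u ∎
  where
  open ≤-Reasoning
  T = heavyBound t
  cod : Fin n → ℕ
  cod = codegree E u
  pointwise : ∀ v → ind (U v) * ind (nonHeavy E t u v) * cod v ≤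
                    ind (does (u Fin.≟ v)) * cod v + T * (ind (U v) * ind (light E t u v))
  pointwise v with U v | does (u Fin.≟ v) | does (cod v <? T) in small | does (0 <? cod v) in pos
  ... | false | _     | _     | _     = z≤n
  ... | true  | true  | _     | _     = m≤m+n _ _
  ... | true  | false | false | _     = z≤n
  ... | true  | false | true  | false = ≤-trans (≤-reflexive (*-identityˡ (cod v))) (≤-trans (≮⇒≥ (does-false⇒ (0 <? cod v) pos)) z≤n)
  ... | true  | false | true  | true  = ≤-trans (≤-reflexive (*-identityˡ (cod v)))
                                          (≤-trans (<⇒≤ (does-true⇒ (cod v <? T) small)) (≤-reflexive (sym (*-identityʳ T))))

-- Let s w be the number of neighbours of w in U, with total σ. Cauchy-Schwarz bounds σ² by |B|
-- times the sum of the s w². Each s w² is at most 4t times the number of non-heavy ordered pairs in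
-- that neighbourhood, as it has no heavy t-clique. Over all w these pairs are counted with their
-- codegrees, which `nonHeavy-codegree-sum` bounds through light pairs.
light-pairs-abundant : ∀ {t} (G : Graph n) → ¬ Contains (SubdivK t) G →
  ∀ (E : Fin n → Fin n → Bool) → (∀ u w → E u w ≡ true → adj G u w ≡ true) →
  ∀ (B : Fin n → Bool) → (∀ u w → E u w ≡ true → B w ≡ true) →
  ∀ (U : Fin n → Bool) {δ} → heavyBound t ≤ δ → (∀ u → U u ≡ true → δ ≤ degree E u) →
  8 * t * count B ≤ count U * δ →
  (count U * δ) * (count U * δ) ≤
    8 * t * heavyBound t * count B * ∑[ u < n ] (ind (U u) * lightDegree E t U u)
light-pairs-abundant {n} {t} G free E E⊆G B E⊆B U {δ} T≤δ U-deg large = begin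
  X * X                       ≤⟨ *-mono-≤ X≤σ X≤σ ⟩
  σ * σ                       ≤⟨ cauchy ⟩
  b * Q                       ≤⟨ +-cancelˡ-≤ (b * Q) _ _ doubled ⟩
  8 * t * T * b * M           ∎
  where
  open ≤-Reasoning
  T = heavyBound t
  X = count U * δ
  b = count B
  e : Fin n → Fin n → ℕ
  e u w = ind (E u w)
  L : Fin n → Fin n → ℕ
  L u v = ind (nonHeavy E t u v)
  s : Fin n → ℕ
  s w = ∑[ v < n ] (ind (U v) * e v w)
  σ = sum s
  Q = ∑[ w < n ] (s w * s w)
  M = ∑[ u < n ] (ind (U u) * lightDegree E t U u)

  σ≡ : σ ≡ ∑[ v < n ] (ind (U v) * degree E v)
  σ≡ = trans (∑-comm (λ w v → ind (U v) * e v w)) (sum-cong-≗ {n} (λ v → sym (*-distribˡ-sum (ind (U v)) (e v))))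

  X≤σ : X ≤ σ
  X≤σ = ≤-trans (weighted-sum-≥ U U-deg) (≤-reflexive (sym σ≡))

  cauchy : σ * σ ≤ b * Q
  cauchy = cauchy-schwarz B s supported
    where
    supported : ∀ w → B w ≡ false → s w ≡ 0
    supported w Bw = trans (sum-cong-≗ {n} vanish) (sum-replicate-zero n)
      where
      vanish : ∀ v → ind (U v) * e v w ≡ 0
      vanish v with E v w in eq
      ... | false = *-zeroʳ (ind (U v))
      ... | true  = contradiction (trans (sym (E⊆B v w eq)) Bw) λ ()

  S : Fin n → Fin n → Bool
  S w v = U v ∧ E v w

  count-S : ∀ w → count (S w) ≡ s w
  count-S w = sum-cong-≗ {n} (λ v → ind-∧ (U v) (E v w))

  regroup : ∀ a b c d l → a * b * (c * d * l) ≡ a * (c * l * (b * d))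
  regroup = solve-∀

  column : ∀ w → s w * s w ≤ 4 * t * ∑[ u < n ] ∑[ v < n ] (ind (U u) * (ind (U v) * L u v * (e u w * e v w)))
  column w = begin
    s w * s w                       ≡⟨ sym (cong₂ _*_ (count-S w) (count-S w)) ⟩
    count (S w) * count (S w)
      ≤⟨ dense-if-no-independent-set t (nonHeavy E t) (S w)
           (no-heavy-clique G free E E⊆G (S w) (λ u Su → ≤-trans T≤δ (U-deg u (∧-trueˡ (U u) Su)))) ⟩
    4 * t * ∑[ u < n ] (ind (S w u) * ∑[ v < n ] (ind (S w v) * L u v))
      ≡⟨ cong (4 * t *_) (sum-cong-≗ {n} (λ u → *-distribˡ-sum (ind (S w u)) (λ v → ind (S w v) * L u v))) ⟩
    4 * t * ∑[ u < n ] ∑[ v < n ] (ind (S w u) * (ind (S w v) * L u v))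
      ≡⟨ cong (4 * t *_) (sum-cong-≗ {n} (λ u → sum-cong-≗ {n} (λ v →
           trans (cong₂ (λ x y → x * (y * L u v)) (ind-∧ (U u) (E u w)) (ind-∧ (U v) (E v w)))
                 (regroup (ind (U u)) (e u w) (ind (U v)) (e v w) (L u v))))) ⟩
    4 * t * ∑[ u < n ] ∑[ v < n ] (ind (U u) * (ind (U v) * L u v * (e u w * e v w))) ∎

  -- Double counting: a pair u, v lies in the neighbourhood of w for exactly `codegree E u v`
  -- vertices w.
  exchange : ∑[ w < n ] ∑[ u < n ] ∑[ v < n ] (ind (U u) * (ind (U v) * L u v * (e u w * e v w)))
             ≡ ∑[ u < n ] (ind (U u) * ∑[ v < n ] (ind (U v) * L u v * codegree E u v))
  exchange = trans (∑-comm (λ w u → ∑[ v < n ] (ind (U u) * (ind (U v) * L u v * (e u w * e v w)))))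
    (sum-cong-≗ {n} (λ u →
      trans (∑-comm (λ w v → ind (U u) * (ind (U v) * L u v * (e u w * e v w))))
        (trans (sum-cong-≗ {n} (λ v →
            trans (sym (*-distribˡ-sum (ind (U u)) (λ w → ind (U v) * L u v * (e u w * e v w))))
                  (cong (ind (U u) *_) (sym (*-distribˡ-sum (ind (U v) * L u v) (λ w → e u w * e v w))))))
          (sym (*-distribˡ-sum (ind (U u)) (λ v → ind (U v) * L u v * codegree E u v))))))

  expand : ∀ i d T l → i * (d + T * l) ≡ i * d + T * (i * l)
  expand = solve-∀

  Q-bound : Q ≤ 4 * t * (σ + T * M)
  Q-bound = begin
    Q ≤⟨ sum-mono-≤ column ⟩
    ∑[ w < n ] (4 * t * ∑[ u < n ] ∑[ v < n ] (ind (U u) * (ind (U v) * L u v * (e u w * e v w))))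
      ≡⟨ sym (*-distribˡ-sum (4 * t) (λ w → ∑[ u < n ] ∑[ v < n ] (ind (U u) * (ind (U v) * L u v * (e u w * e v w))))) ⟩
    4 * t * ∑[ w < n ] ∑[ u < n ] ∑[ v < n ] (ind (U u) * (ind (U v) * L u v * (e u w * e v w)))
      ≡⟨ cong (4 * t *_) exchange ⟩
    4 * t * ∑[ u < n ] (ind (U u) * ∑[ v < n ] (ind (U v) * L u v * codegree E u v))
      ≤⟨ *-monoʳ-≤ (4 * t) (sum-mono-≤ (λ u → *-monoʳ-≤ (ind (U u)) (nonHeavy-codegree-sum E t U u))) ⟩
    4 * t * ∑[ u < n ] (ind (U u) * (degree E u + T * lightDegree E t U u))
      ≡⟨ cong (4 * t *_) (sum-cong-≗ {n} (λ u → expand (ind (U u)) (degree E u) T (lightDegree E t U u))) ⟩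
    4 * t * ∑[ u < n ] (ind (U u) * degree E u + T * (ind (U u) * lightDegree E t U u))
      ≡⟨ cong (4 * t *_) (∑-distrib-+ (λ u → ind (U u) * degree E u) (λ u → T * (ind (U u) * lightDegree E t U u))) ⟩
    4 * t * (∑[ u < n ] (ind (U u) * degree E u) + ∑[ u < n ] (T * (ind (U u) * lightDegree E t U u)))
      ≡⟨ cong (4 * t *_) (cong₂ _+_ (sym σ≡) (sym (*-distribˡ-sum T (λ u → ind (U u) * lightDegree E t U u)))) ⟩
    4 * t * (σ + T * M) ∎

  shape₁ : ∀ b Q → b * Q + b * Q ≡ 2 * b * Q
  shape₁ = solve-∀
  shape₂ : ∀ b t σ T M → 2 * b * (4 * t * (σ + T * M)) ≡ 8 * t * b * σ + 8 * t * T * b * M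
  shape₂ = solve-∀

  -- The diagonal pairs contribute 8tbσ, which is at most σ² because 8tb ≤ X ≤ σ; one of the two
  -- copies of b Q absorbs it.
  doubled : b * Q + b * Q ≤ b * Q + 8 * t * T * b * M
  doubled = begin
    b * Q + b * Q                        ≡⟨ shape₁ b Q ⟩
    2 * b * Q                            ≤⟨ *-monoʳ-≤ (2 * b) Q-bound ⟩
    2 * b * (4 * t * (σ + T * M))        ≡⟨ shape₂ b t σ T M ⟩
    8 * t * b * σ + 8 * t * T * b * M    ≤⟨ +-monoˡ-≤ _ (*-monoˡ-≤ σ (≤-trans large X≤σ)) ⟩
    σ * σ + 8 * t * T * b * M            ≤⟨ +-monoˡ-≤ _ cauchy ⟩
    b * Q + 8 * t * T * b * M            ∎

-- Growing a light clique

above-average : ∀ (U : Fin n → Bool) (f : Fin n → ℕ) {y} → 0 < count U →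
  count U * y ≤ ∑[ u < n ] (ind (U u) * f u) → ∃[ u ] U u ≡ true × y ≤ f u
above-average {n} U f {y} U>0 total with Fin.any? (λ u → (U u Bool.≟ true) ×-dec (y ≤? f u))
... | yes found = found
-- If f u < y held throughout U, the gain of 1 at each u would add up to count U ≤ 0.
... | no ¬found = contradiction U>0 (≤⇒≯ (+-cancelʳ-≤ (∑[ u < n ] (ind (U u) * f u)) _ 0 (begin
  count U + ∑[ u < n ] (ind (U u) * f u)        ≡⟨ sym (∑-distrib-+ (ind ∘ U) (λ u → ind (U u) * f u)) ⟩
  ∑[ u < n ] (ind (U u) + ind (U u) * f u)      ≡⟨ sum-cong-≗ {n} (λ u → sym (*-suc (ind (U u)) (f u))) ⟩
  ∑[ u < n ] (ind (U u) * suc (f u))            ≤⟨ weighted-sum-≤ U (λ u Uu → ≰⇒> (λ y≤fu → ¬found (u , Uu , y≤fu))) ⟩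
  count U * y                                   ≤⟨ total ⟩
  ∑[ u < n ] (ind (U u) * f u)                  ∎)))
  where open ≤-Reasoning

reflexive-column : ∀ (E : Fin n → Fin n → Bool) w →
  ∑[ v < n ] reflexive E v w ≡ 1 + ∑[ v < n ] ind (E v w)
reflexive-column {n} E w = trans (∑-distrib-+ (λ v → ind (does (v Fin.≟ w))) (λ v → ind (E v w)))
  (cong (_+ ∑[ v < n ] ind (E v w)) (trans (sum-cong-≗ {n} flip) (sum-select w (λ _ → 1))))
  where
  flip : ∀ v → ind (does (v Fin.≟ w)) ≡ ind (does (w Fin.≟ v)) * 1
  flip v with v Fin.≟ w
  ... | yes refl = sym (cong (λ b → ind b * 1) (⇒does-true (v Fin.≟ v) refl))
  ... | no v≢w   = sym (cong (λ b → ind b * 1) (⇒does-false (w Fin.≟ v) (v≢w ∘ sym)))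

-- The 3 collects the terms with a loop: at w = x at most 2, and the remaining one at w = y at most
-- 1.
reflexive-codegree : ∀ (E : Fin n → Fin n → Bool) x y →
  ∑[ w < n ] (reflexive E x w * reflexive E y w) ≤ 3 + codegree E x y
reflexive-codegree {n} E x y = begin
  ∑[ w < n ] (reflexive E x w * reflexive E y w)
    ≡⟨ sum-cong-≗ {n} (λ w → expand (ind (does (x Fin.≟ w))) (ind (E x w)) (ind (does (y Fin.≟ w))) (ind (E y w))) ⟩
  ∑[ w < n ] (ind (does (x Fin.≟ w)) * reflexive E y w + (ind (does (y Fin.≟ w)) * ind (E x w) + ind (E x w) * ind (E y w)))
    ≡⟨ ∑-distrib-+ (λ w → ind (does (x Fin.≟ w)) * reflexive E y w) _ ⟩
  ∑[ w < n ] (ind (does (x Fin.≟ w)) * reflexive E y w) + ∑[ w < n ] (ind (does (y Fin.≟ w)) * ind (E x w) + ind (E x w) * ind (E y w))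
    ≡⟨ cong₂ _+_ (sum-select x (reflexive E y)) (∑-distrib-+ (λ w → ind (does (y Fin.≟ w)) * ind (E x w)) _) ⟩
  reflexive E y x + (∑[ w < n ] (ind (does (y Fin.≟ w)) * ind (E x w)) + codegree E x y)
    ≡⟨ cong (λ z → reflexive E y x + (z + codegree E x y)) (sum-select y (λ w → ind (E x w))) ⟩
  reflexive E y x + (ind (E x y) + codegree E x y)
    ≤⟨ +-mono-≤ (+-mono-≤ (ind≤1 (does (y Fin.≟ x))) (ind≤1 (E y x))) (+-monoˡ-≤ (codegree E x y) (ind≤1 (E x y))) ⟩
  3 + codegree E x y ∎
  where
  open ≤-Reasoning
  expand : ∀ a b c d → (a + b) * (c + d) ≡ a * (c + d) + (c * b + b * d)
  expand = solve-∀

-- The fields `distinct`, `linked` and `disj` are the hypotheses of `light-clique⇒subdivision` for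
-- the vertices chosen so far. `U` holds the candidates: `U-light` and `U-disj` ensure that any of
-- them can be appended.
record Stage (E : Fin n → Fin n → Bool) (t : ℕ) (A : Fin n → Bool) (k : ℕ) : Set where
  field
    us       : Fin k → Fin n
    U        : Fin n → Bool
    U⊆A      : ∀ v → U v ≡ true → A v ≡ true
    distinct : ∀ {i j} → i <F j → us i ≢ us j
    linked   : ∀ {i j} → i <F j → ∃[ w ] E (us i) w ≡ true × E (us j) w ≡ true
    disj     : ∀ {i j l} → i ≢ j → i ≢ l → j ≢ l → Disjointed E (us i) (us j) (us l)
    U-light  : ∀ v → U v ≡ true → ∀ i → light E t (us i) v ≡ true
    U-disj   : ∀ v → U v ≡ true → ∀ {i j} → i ≢ j → Disjointed E (us i) (us j) v

initial-stage : ∀ (E : Fin n → Fin n → Bool) t A → Stage E t A 0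
initial-stage E t A = record
  { us = λ () ; U = A ; U⊆A = λ _ eq → eq ; distinct = λ { {()} } ; linked = λ { {()} }
  ; disj = λ { {()} } ; U-light = λ _ _ () ; U-disj = λ { _ _ {()} } }

Disjointed-swap : ∀ (E : Fin n → Fin n → Bool) {x y z} → Disjointed E x y z → Disjointed E y x z
Disjointed-swap E {x} {y} {z} d w = trans (swap (reflexive E y w) (reflexive E x w) (reflexive E z w)) (d w)
  where
  swap : ∀ a b c → a * (b * c) ≡ b * (a * c)
  swap = solve-∀

Disjointed-rotate : ∀ (E : Fin n → Fin n → Bool) {x y z} → Disjointed E x y z → Disjointed E z x y
Disjointed-rotate E {x} {y} {z} d w = trans (rotate (reflexive E z w) (reflexive E x w) (reflexive E y w)) (d w)
  where
  rotate : ∀ a b c → a * (b * c) ≡ b * (c * a)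
  rotate = solve-∀

light⇒distinct : ∀ (E : Fin n → Fin n → Bool) t u v → light E t u v ≡ true → u ≢ v
light⇒distinct E t u v l u≡v rewrite ⇒does-true (u Fin.≟ v) u≡v = contradiction l λ ()

light⇒linked : ∀ (E : Fin n → Fin n → Bool) t u v → light E t u v ≡ true →
               ∃[ w ] E u w ≡ true × E v w ≡ true
light⇒linked {n} E t u v l
  with w , pos ← sum-positive _ (does-true⇒ (0 <? codegree E u v) (∧-trueˡ _ (∧-trueʳ (not (does (u Fin.≟ v))) l)))
  = w , ∧-trueˡ (E u w) both , ∧-trueʳ (E u w) both
  where
  both : E u w ∧ E v w ≡ true
  both = ind>0⇒true _ (≤-trans pos (≤-reflexive (sym (ind-∧ (E u w) (E v w)))))

light⇒small-codegree : ∀ (E : Fin n → Fin n → Bool) t u v → light E t u v ≡ true → codegree E u v < heavyBound t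
light⇒small-codegree E t u v l =
  does-true⇒ (codegree E u v <? heavyBound t)
    (∧-trueʳ (does (0 <? codegree E u v)) (∧-trueʳ (not (does (u Fin.≟ v))) l))

module _ {E : Fin n → Fin n → Bool} {t : ℕ} {A : Fin n → Bool} {k : ℕ} (st : Stage E t A k) where
  open Stage st

  private
    -- Zero exactly when `Disjointed E (us i) u v` holds for every i; as a number it can be summed
    -- over v to bound the deletions.
    bad : Fin n → Fin n → ℕ
    bad u v = ∑[ i < k ] ∑[ w < n ] (reflexive E (us i) w * (reflexive E u w * reflexive E v w))

    U′ : Fin n → Fin n → Bool
    U′ u v = U v ∧ (light E t u v ∧ does (bad u v ≟ 0))

  extend-stage : ∀ u → U u ≡ true → Stage E t A (suc k)
  extend-stage u Uu = record
    { us = u ∷ us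
    ; U = U′ u
    ; U⊆A = λ v eq → U⊆A v (∧-trueˡ (U v) eq)
    ; distinct = distinct′
    ; linked = linked′
    ; disj = λ {i} {j} {l} → disj′ i j l
    ; U-light = U-light′
    ; U-disj = λ v eq {i} {j} → U-disj′ v eq i j
    }
    where
    distinct′ : ∀ {i j} → i <F j → (u ∷ us) i ≢ (u ∷ us) j
    distinct′ {zero}  {suc j} _         = light⇒distinct E t (us j) u (U-light u Uu j) ∘ sym
    distinct′ {suc i} {suc j} (s<s i<j) = distinct i<j
    linked′ : ∀ {i j} → i <F j → ∃[ w ] E ((u ∷ us) i) w ≡ true × E ((u ∷ us) j) w ≡ true
    linked′ {zero}  {suc j} _ with w , p , q ← light⇒linked E t (us j) u (U-light u Uu j) = w , q , p
    linked′ {suc i} {suc j} (s<s i<j) = linked i<j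
    -- `U-disj` provides the triples with the new vertex last; the other positions follow by
    -- permuting the arguments of `Disjointed`.
    disj′ : ∀ i j l → i ≢ j → i ≢ l → j ≢ l → Disjointed E ((u ∷ us) i) ((u ∷ us) j) ((u ∷ us) l)
    disj′ zero    zero    l       i≢j _   _   = contradiction refl i≢j
    disj′ zero    (suc j) zero    _   i≢l _   = contradiction refl i≢l
    disj′ (suc i) zero    zero    _   _   j≢l = contradiction refl j≢l
    disj′ zero    (suc j) (suc l) _   _   j≢l = Disjointed-rotate E {us j} {us l} {u} (U-disj u Uu (j≢l ∘ cong suc))
    disj′ (suc i) zero    (suc l) _   i≢l _   =
      Disjointed-swap E {u} {us i} {us l} (Disjointed-rotate E {us i} {us l} {u} (U-disj u Uu (i≢l ∘ cong suc)))
    disj′ (suc i) (suc j) zero    i≢j _   _   = U-disj u Uu (i≢j ∘ cong suc)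
    disj′ (suc i) (suc j) (suc l) i≢j i≢l j≢l = disj (i≢j ∘ cong suc) (i≢l ∘ cong suc) (j≢l ∘ cong suc)
    U-light′ : ∀ v → U′ u v ≡ true → ∀ i → light E t ((u ∷ us) i) v ≡ true
    U-light′ v eq zero    = ∧-trueˡ (light E t u v) (∧-trueʳ (U v) eq)
    U-light′ v eq (suc i) = U-light v (∧-trueˡ (U v) eq) i
    not-bad : ∀ v → U′ u v ≡ true → ∀ i → Disjointed E (us i) u v
    not-bad v eq i = sum≡0⇒term≡0 _ (sum≡0⇒term≡0 _
      (does-true⇒ (bad u v ≟ 0) (∧-trueʳ (light E t u v) (∧-trueʳ (U v) eq))) i)
    U-disj′ : ∀ v → U′ u v ≡ true → ∀ i j → i ≢ j → Disjointed E ((u ∷ us) i) ((u ∷ us) j) v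
    U-disj′ v eq zero    zero    i≢j = contradiction refl i≢j
    U-disj′ v eq zero    (suc j) _   = Disjointed-swap E {us j} {u} {v} (not-bad v eq j)
    U-disj′ v eq (suc i) zero    _   = not-bad v eq i
    U-disj′ v eq (suc i) (suc j) i≢j = U-disj v (∧-trueˡ (U v) eq) (i≢j ∘ cong suc)

  -- Every light neighbour of u in U that is deleted has `bad u v` ≥ 1. For each i the pair us i, u
  -- is light, so it has at most 3 + T common neighbours with loops counted, and each of these
  -- spoils at most 1 + Δ vertices v.
  extend-stage-size : ∀ {Δ} → (∀ w → ∑[ v < n ] ind (E v w) ≤ Δ) → ∀ u (Uu : U u ≡ true) →
    lightDegree E t U u ≤ count (Stage.U (extend-stage u Uu)) + k * ((3 + heavyBound t) * (1 + Δ))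
  extend-stage-size {Δ} columns u Uu = begin
    lightDegree E t U u                          ≤⟨ sum-mono-≤ pointwise ⟩
    ∑[ v < n ] (ind (U′ u v) + bad u v)          ≡⟨ ∑-distrib-+ (ind ∘ U′ u) (bad u) ⟩
    count (U′ u) + sum (bad u)                   ≡⟨ cong (count (U′ u) +_) (∑-comm (λ v i → ∑[ w < n ] (F (us i) w * (F u w * F v w)))) ⟩
    count (U′ u) + ∑[ i < k ] ∑[ v < n ] ∑[ w < n ] (F (us i) w * (F u w * F v w))
      ≤⟨ +-monoʳ-≤ (count (U′ u)) (sum-≤-const bad-at) ⟩
    count (U′ u) + k * ((3 + heavyBound t) * (1 + Δ)) ∎
    where
    open ≤-Reasoning
    F : Fin n → Fin n → ℕ
    F = reflexive E
    pointwise : ∀ v → ind (U v) * ind (light E t u v) ≤ ind (U′ u v) + bad u v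
    pointwise v with U v | light E t u v | does (bad u v ≟ 0) in eq
    ... | false | _     | _     = z≤n
    ... | true  | false | _     = z≤n
    ... | true  | true  | true  = s≤s z≤n
    ... | true  | true  | false = n≢0⇒n>0 (does-false⇒ (bad u v ≟ 0) eq)
    bad-at : ∀ i → ∑[ v < n ] ∑[ w < n ] (F (us i) w * (F u w * F v w)) ≤ (3 + heavyBound t) * (1 + Δ)
    bad-at i = begin
      ∑[ v < n ] ∑[ w < n ] (F (us i) w * (F u w * F v w)) ≡⟨ ∑-comm (λ v w → F (us i) w * (F u w * F v w)) ⟩
      ∑[ w < n ] ∑[ v < n ] (F (us i) w * (F u w * F v w))
        ≡⟨ sum-cong-≗ {n} (λ w → trans (sum-cong-≗ {n} (λ v → sym (*-assoc (F (us i) w) (F u w) (F v w))))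
                                       (sym (*-distribˡ-sum (F (us i) w * F u w) (λ v → F v w)))) ⟩
      ∑[ w < n ] (F (us i) w * F u w * ∑[ v < n ] F v w)
        ≤⟨ sum-mono-≤ (λ w → *-monoʳ-≤ (F (us i) w * F u w)
             (≤-trans (≤-reflexive (reflexive-column E w)) (s≤s (columns w)))) ⟩
      ∑[ w < n ] (F (us i) w * F u w * (1 + Δ))            ≡⟨ sym (*-distribʳ-sum (1 + Δ) (λ w → F (us i) w * F u w)) ⟩
      ∑[ w < n ] (F (us i) w * F u w) * (1 + Δ)
        ≤⟨ *-monoˡ-≤ (1 + Δ) (≤-trans (reflexive-codegree E (us i) u)
             (+-monoʳ-≤ 3 (<⇒≤ (light⇒small-codegree E t (us i) u (U-light u Uu i))))) ⟩
      (3 + heavyBound t) * (1 + Δ) ∎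

-- Dominates the constants 8t, 16t(t + t²) and 2t(3 + t + t²) that R has to absorb.
κ : ℕ → ℕ
κ t = 16 * t * (4 + heavyBound t)

-- Powers of R in one growth step

^-split : ∀ R {x} y z → x ≡ y + z → R ^ x ≡ R ^ y * R ^ z
^-split R y z refl = ^-distribˡ-+-* R y z

-- Here a = |A| and b = |B|, row degrees are at least R^d and column degrees at most R^(c+1). Each
-- step may shrink the candidate set by a factor R^13, so `Z` = R^(13t) bounds the loss over all t
-- steps.
module GrowthArithmetic (t R c d a b : ℕ) .{{_ : NonZero R}} .{{_ : NonZero b}} (1≤t : 1 ≤ t) (κ≤R : κ t ≤ R)
  (c-large : 13 * t + 3 ≤ c) (d-large : 13 * t + 6 ≤ d)
  (ab : b * R ^ c ≤ a * R ^ (d + 2)) (b-small : b ≤ R ^ (2 * d + 12)) where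

  private
    T = heavyBound t
    Z = R ^ (13 * t)
    ZR^≢0 : ∀ x → NonZero (Z * R ^ x)
    ZR^≢0 x = m*n≢0 Z (R ^ x) {{m^n≢0 R (13 * t)}} {{m^n≢0 R x}}

  ≤κ⇒≤R : ∀ {x} → x ≤ κ t → x ≤ R
  ≤κ⇒≤R x≤κ = ≤-trans x≤κ κ≤R

  t≤κ/16 : t ≤ t * (4 + T)
  t≤κ/16 = m≤m*n t (4 + T)

  8t≤R : 8 * t ≤ R
  8t≤R = ≤κ⇒≤R (≤-trans (*-mono-≤ {8} {16} (m≤m+n 8 8) t≤κ/16) (≤-reflexive (sym (*-assoc 16 t (4 + T)))))

  2≤R : 2 ≤ R
  2≤R = ≤-trans (≤-trans (m≤m+n 2 6) (m≤m*n 8 t {{>-nonZero 1≤t}})) 8t≤R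

  16tT≤R : 16 * t * T ≤ R
  16tT≤R = ≤κ⇒≤R (*-monoʳ-≤ (16 * t) (m≤n+m T 4))

  T≤R : T ≤ R
  T≤R = ≤-trans (m≤n*m T (16 * t) {{m*n≢0 16 t {{_}} {{>-nonZero 1≤t}}}}) 16tT≤R

  2t[3+T]≤R : t * (3 + T) * 2 ≤ R
  2t[3+T]≤R = ≤κ⇒≤R (begin
    t * (3 + T) * 2    ≡⟨ shape t T ⟩
    2 * t * (3 + T)    ≤⟨ *-mono-≤ (*-monoˡ-≤ t (m≤m+n 2 14)) (n≤1+n (3 + T)) ⟩
    κ t                ∎)
    where
    open ≤-Reasoning
    shape : ∀ t T → t * (3 + T) * 2 ≡ 2 * t * (3 + T)
    shape = solve-∀

  T≤δ : T ≤ R ^ d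
  T≤δ = ≤-trans T≤R (≤-trans (≤-reflexive (sym (^-identityʳ R)))
          (^-monoʳ-≤ R (≤-trans (m≤n+m 1 (13 * t + 5)) (≤-trans (≤-reflexive (+-assoc (13 * t) 5 1)) d-large))))

  module _ (U : ℕ) (U-large : a ≤ U * Z) where
    open ≤-Reasoning

    bR^c≤ : b * R ^ c ≤ U * R ^ d * (Z * R ^ 2)
    bR^c≤ = begin
      b * R ^ c              ≤⟨ ab ⟩
      a * R ^ (d + 2)        ≤⟨ *-monoˡ-≤ (R ^ (d + 2)) U-large ⟩
      U * Z * R ^ (d + 2)    ≡⟨ cong (U * Z *_) (^-distribˡ-+-* R d 2) ⟩
      U * Z * (R ^ d * R ^ 2) ≡⟨ shape U Z (R ^ d) (R ^ 2) ⟩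
      U * R ^ d * (Z * R ^ 2) ∎
      where
      shape : ∀ U Z x y → U * Z * (x * y) ≡ U * x * (Z * y)
      shape = solve-∀

    -- The exponent 13t + 3 required of c: 13t for the shrinking of U, 2 for the slack in `ab`, 1
    -- for the constant 8t.
    8tb≤Uδ : 8 * t * b ≤ U * R ^ d
    8tb≤Uδ = *-cancelʳ-≤ _ _ (Z * R ^ 2) {{ZR^≢0 2}} (begin
      8 * t * b * (Z * R ^ 2)   ≤⟨ *-monoˡ-≤ (Z * R ^ 2) (*-monoˡ-≤ b 8t≤R) ⟩
      R * b * (Z * R ^ 2)       ≡⟨ shape R b Z ⟩
      b * (Z * R ^ 3)           ≡⟨ cong (b *_) (sym (^-distribˡ-+-* R (13 * t) 3)) ⟩
      b * R ^ (13 * t + 3)      ≤⟨ *-monoʳ-≤ b (^-monoʳ-≤ R c-large) ⟩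
      b * R ^ c                 ≤⟨ bR^c≤ ⟩
      U * R ^ d * (Z * R ^ 2)   ∎)
      where
      shape : ∀ R b Z → R * b * (Z * (R * (R * 1))) ≡ b * (Z * (R * (R * (R * 1))))
      shape = solve-∀

    U>0 : 0 < U
    U>0 = n≢0⇒n>0 λ U≡0 → ≢-nonZero⁻¹ (8 * t * b) {{m*n≢0 (8 * t) b {{m*n≢0 8 t {{_}} {{>-nonZero 1≤t}}}}}}
      (n≤0⇒n≡0 (subst (λ z → 8 * t * b ≤ z * R ^ d) U≡0 8tb≤Uδ))

    module _ (m : ℕ) (m-large : U * R ^ d * R ^ d ≤ 8 * t * T * b * m) where

      -- The exponent 13t + 6 required of d: 13t for `Z`, 2 for the slack in `ab`, 1 for the
      -- constant 8tT, and 3 for the surplus over R^c.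
      R^c+3≤m : R ^ (c + 3) ≤ m
      R^c+3≤m = *-cancelˡ-≤ b (*-cancelʳ-≤ _ _ (Z * R ^ 3) {{ZR^≢0 3}} (begin
        b * R ^ (c + 3) * (Z * R ^ 3)        ≡⟨ cong (λ z → b * z * (Z * R ^ 3)) (^-distribˡ-+-* R c 3) ⟩
        b * (R ^ c * R ^ 3) * (Z * R ^ 3)    ≡⟨ shape₁ b (R ^ c) R Z ⟩
        b * R ^ c * (Z * R ^ 6)              ≡⟨ cong (b * R ^ c *_) (sym (^-distribˡ-+-* R (13 * t) 6)) ⟩
        b * R ^ c * R ^ (13 * t + 6)         ≤⟨ *-monoʳ-≤ (b * R ^ c) (^-monoʳ-≤ R d-large) ⟩
        b * R ^ c * R ^ d                    ≤⟨ *-monoˡ-≤ (R ^ d) bR^c≤ ⟩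
        U * R ^ d * (Z * R ^ 2) * R ^ d      ≡⟨ shape₂ (U * R ^ d) (Z * R ^ 2) (R ^ d) ⟩
        U * R ^ d * R ^ d * (Z * R ^ 2)      ≤⟨ *-monoˡ-≤ (Z * R ^ 2) m-large ⟩
        8 * t * T * b * m * (Z * R ^ 2)      ≤⟨ *-monoˡ-≤ (Z * R ^ 2) (*-monoˡ-≤ m (*-monoˡ-≤ b
                                                  (≤-trans (*-monoˡ-≤ T (*-monoˡ-≤ t (m≤m+n 8 8))) 16tT≤R))) ⟩
        R * b * m * (Z * R ^ 2)              ≡⟨ shape₃ R b m Z ⟩
        b * m * (Z * R ^ 3)                  ∎))
        where
        shape₁ : ∀ b x R Z → b * (x * (R * (R * (R * 1)))) * (Z * (R * (R * (R * 1)))) ≡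
                             b * x * (Z * (R * (R * (R * (R * (R * (R * 1)))))))
        shape₁ = solve-∀
        shape₂ : ∀ x y z → x * y * z ≡ x * z * y
        shape₂ = solve-∀
        shape₃ : ∀ R b m Z → R * b * m * (Z * (R * (R * 1))) ≡ b * m * (Z * (R * (R * (R * 1))))
        shape₃ = solve-∀

      module _ (k U′ : ℕ) (k≤t : k ≤ t) (m-bound : m ≤ U′ + k * ((3 + T) * (1 + R ^ (c + 1)))) where

        -- The deletions are of order R^(c+1), and their constants cost two factors R; hence at
        -- least half of the m light neighbours survive.
        2bad≤m : 2 * (k * ((3 + T) * (1 + R ^ (c + 1)))) ≤ m
        2bad≤m = begin
          2 * (k * ((3 + T) * (1 + R ^ (c + 1))))
            ≤⟨ *-monoʳ-≤ 2 (*-mono-≤ k≤t (*-monoʳ-≤ (3 + T) (+-monoˡ-≤ (R ^ (c + 1)) (m^n>0 R (c + 1))))) ⟩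
          2 * (t * ((3 + T) * (R ^ (c + 1) + R ^ (c + 1))))  ≡⟨ shape t T (R ^ (c + 1)) ⟩
          2 * (t * (3 + T) * 2 * R ^ (c + 1))    ≤⟨ *-mono-≤ 2≤R (*-monoˡ-≤ (R ^ (c + 1)) 2t[3+T]≤R) ⟩
          R * (R * R ^ (c + 1))                  ≡⟨ cong (R ^_) (trans (cong (2 +_) (+-comm c 1)) (+-comm 3 c)) ⟩
          R ^ (c + 3)                            ≤⟨ R^c+3≤m ⟩
          m                                      ∎
          where
          shape : ∀ t T x → 2 * (t * ((3 + T) * (x + x))) ≡ 2 * (t * (3 + T) * 2 * x)
          shape = solve-∀

        m≤2U′ : m ≤ 2 * U′
        m≤2U′ = +-cancelʳ-≤ m _ _ (begin
          m + m                        ≡⟨ cong (m +_) (sym (+-identityʳ m)) ⟩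
          2 * m                        ≤⟨ *-monoʳ-≤ 2 m-bound ⟩
          2 * (U′ + k * ((3 + T) * (1 + R ^ (c + 1)))) ≡⟨ *-distribˡ-+ 2 U′ _ ⟩
          2 * U′ + 2 * (k * ((3 + T) * (1 + R ^ (c + 1)))) ≤⟨ +-monoʳ-≤ (2 * U′) 2bad≤m ⟩
          2 * U′ + m                   ∎)

        -- The 13 is 12 from `b-small` plus 1 for the constant 16tT.
        U≤U′R¹³ : U ≤ U′ * R ^ 13
        U≤U′R¹³ = *-cancelʳ-≤ _ _ (R ^ d * R ^ d) {{m*n≢0 (R ^ d) (R ^ d) {{m^n≢0 R d}} {{m^n≢0 R d}}}} (begin
          U * (R ^ d * R ^ d)              ≡⟨ sym (*-assoc U (R ^ d) (R ^ d)) ⟩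
          U * R ^ d * R ^ d                ≤⟨ m-large ⟩
          8 * t * T * b * m                ≤⟨ *-monoʳ-≤ (8 * t * T * b) m≤2U′ ⟩
          8 * t * T * b * (2 * U′)         ≡⟨ shape₁ t T b U′ ⟩
          16 * t * T * (b * U′)            ≤⟨ *-mono-≤ 16tT≤R (*-monoˡ-≤ U′ b-small) ⟩
          R * (R ^ (2 * d + 12) * U′)      ≡⟨ sym (*-assoc R (R ^ (2 * d + 12)) U′) ⟩
          R ^ suc (2 * d + 12) * U′        ≡⟨ cong (_* U′) (^-split R (d + d) 13 (shape₂ d)) ⟩
          R ^ (d + d) * R ^ 13 * U′        ≡⟨ cong (λ z → z * R ^ 13 * U′) (^-distribˡ-+-* R d d) ⟩
          R ^ d * R ^ d * R ^ 13 * U′      ≡⟨ shape₃ (R ^ d * R ^ d) (R ^ 13) U′ ⟩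
          U′ * R ^ 13 * (R ^ d * R ^ d)    ∎)
          where
          shape₁ : ∀ t T b x → 8 * t * T * b * (2 * x) ≡ 16 * t * T * (b * x)
          shape₁ = solve-∀
          shape₂ : ∀ d → suc (2 * d + 12) ≡ d + d + 13
          shape₂ = solve-∀
          shape₃ : ∀ x y z → x * y * z ≡ z * y * x
          shape₃ = solve-∀

-- The conclusion is doubly negated because the abundance of light pairs, which feeds the growth, is
-- itself derived from the absence of a copy.
almost-regular-pair⇒subdivision : ∀ {t} (G : Graph n) (E : Fin n → Fin n → Bool) (A B : Fin n → Bool) R c d
  .{{_ : NonZero R}} → 1 ≤ t → κ t ≤ R → 13 * t + 3 ≤ c → 13 * t + 6 ≤ d →
  (∀ u w → E u w ≡ true → adj G u w ≡ true) → (∀ u w → E u w ≡ true → B w ≡ true) →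
  (∀ u → A u ≡ true → R ^ d ≤ degree E u) → (∀ w → ∑[ v < n ] ind (E v w) ≤ R ^ (c + 1)) →
  0 < count B → count B ≤ R ^ (2 * d + 12) → count B * R ^ c ≤ count A * R ^ (d + 2) →
  ¬ ¬ Contains (SubdivK t) G
almost-regular-pair⇒subdivision {n} {t} G E A B R c d 1≤t κ≤R c-large d-large E⊆G E⊆B rows columns B>0 b-small ab free =
  free (embed (proj₁ (grow t ≤-refl)))
  where
  embed : Stage E t A t → Contains (SubdivK t) G
  embed st = light-clique⇒subdivision G E E⊆G us distinct linked disj
    where open Stage st
  instance
    b≢0 : NonZero (count B)
    b≢0 = >-nonZero B>0
  open GrowthArithmetic t R c d (count A) (count B) 1≤t κ≤R c-large d-large ab b-small
  open ≤-Reasoning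
  T = heavyBound t

  grow-step : ∀ {k} → k < t → (st : Stage E t A k) → count A ≤ count (Stage.U st) * R ^ (13 * k) →
              Σ (Stage E t A (suc k)) λ st′ → count A ≤ count (Stage.U st′) * R ^ (13 * suc k)
  -- The light degree is averaged after multiplication by 8tTb, which keeps the threshold |U| δ² an
  -- integer.
  grow-step {k} k<t st inv = continue (above-average U (λ u → 8 * t * T * b * lightDegree E t U u) (U>0 (count U) inv′) total)
    where
    open Stage st
    b = count B
    inv′ : count A ≤ count U * R ^ (13 * t)
    inv′ = ≤-trans inv (*-monoʳ-≤ (count U) (^-monoʳ-≤ R (*-monoʳ-≤ 13 (<⇒≤ k<t))))
    regroup₁ : ∀ u δ → u * (u * δ * δ) ≡ (u * δ) * (u * δ)
    regroup₁ = solve-∀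
    regroup₂ : ∀ c i x → c * (i * x) ≡ i * (c * x)
    regroup₂ = solve-∀
    total : count U * (count U * R ^ d * R ^ d) ≤ ∑[ u < n ] (ind (U u) * (8 * t * T * b * lightDegree E t U u))
    total = begin
      count U * (count U * R ^ d * R ^ d)     ≡⟨ regroup₁ (count U) (R ^ d) ⟩
      (count U * R ^ d) * (count U * R ^ d)
        ≤⟨ light-pairs-abundant G free E E⊆G B E⊆B U T≤δ (λ u Uu → rows u (U⊆A u Uu)) (8tb≤Uδ (count U) inv′) ⟩
      8 * t * T * b * ∑[ u < n ] (ind (U u) * lightDegree E t U u)
        ≡⟨ *-distribˡ-sum (8 * t * T * b) (λ u → ind (U u) * lightDegree E t U u) ⟩
      ∑[ u < n ] (8 * t * T * b * (ind (U u) * lightDegree E t U u))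
        ≡⟨ sum-cong-≗ {n} (λ u → regroup₂ (8 * t * T * b) (ind (U u)) (lightDegree E t U u)) ⟩
      ∑[ u < n ] (ind (U u) * (8 * t * T * b * lightDegree E t U u)) ∎
    continue : ∃[ u ] U u ≡ true × count U * R ^ d * R ^ d ≤ 8 * t * T * b * lightDegree E t U u →
               Σ (Stage E t A (suc k)) λ st′ → count A ≤ count (Stage.U st′) * R ^ (13 * suc k)
    continue (u , Uu , m-large) = extend-stage st u Uu , (begin
      count A                             ≤⟨ inv ⟩
      count U * R ^ (13 * k)
        ≤⟨ *-monoˡ-≤ (R ^ (13 * k)) (U≤U′R¹³ (count U) inv′ _ m-large k U′ (<⇒≤ k<t) (extend-stage-size st columns u Uu)) ⟩
      U′ * R ^ 13 * R ^ (13 * k)          ≡⟨ *-assoc U′ (R ^ 13) (R ^ (13 * k)) ⟩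
      U′ * (R ^ 13 * R ^ (13 * k))        ≡⟨ cong (U′ *_) (sym (^-split R 13 (13 * k) (*-suc 13 k))) ⟩
      U′ * R ^ (13 * suc k)               ∎)
      where U′ = count (Stage.U (extend-stage st u Uu))

  grow : ∀ k → k ≤ t → Σ (Stage E t A k) λ st → count A ≤ count (Stage.U st) * R ^ (13 * k)
  grow zero    _   = initial-stage E t A , ≤-reflexive (sym (*-identityʳ (count A)))
  grow (suc k) k<t with st , inv ← grow k (<⇒≤ k<t) = grow-step k<t st inv

-- Degree classes

-- Averaging over the M class totals, each multiplied by M to avoid division.
pigeonhole : ∀ M (cl : Fin n → ℕ) → (∀ x → cl x < M) → 0 < M → (f : Fin n → ℕ) →
  ∃[ c ] sum f ≤ M * ∑[ x < n ] (ind (does (cl x ≟ c)) * f x)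
pigeonhole {n} M cl cl<M M>0 f =
  let c , _ , large = above-average {M} (λ _ → true) (λ c → M * part c) (≤-trans M>0 (≤-reflexive (sym count-all))) total
  in toℕ c , large
  where
  open ≤-Reasoning
  part : Fin M → ℕ
  part c = ∑[ x < n ] (ind (does (cl x ≟ toℕ c)) * f x)
  count-all : count {M} (λ _ → true) ≡ M
  count-all = trans (sum-const M 1) (*-identityʳ M)
  covered : ∀ x → f x ≤ ∑[ c < M ] (ind (does (cl x ≟ toℕ c)) * f x)
  covered x = begin
    f x                                    ≡⟨ sym (*-identityˡ (f x)) ⟩
    1 * f x                                ≡⟨ cong (λ b → ind b * f x) (sym (⇒does-true (cl x ≟ toℕ c) (sym (Fin.toℕ-fromℕ< (cl<M x))))) ⟩
    ind (does (cl x ≟ toℕ c)) * f x        ≤⟨ term≤sum (λ c → ind (does (cl x ≟ toℕ c)) * f x) c ⟩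
    ∑[ c < M ] (ind (does (cl x ≟ toℕ c)) * f x) ∎
    where c = fromℕ< (cl<M x)
  total : count {M} (λ _ → true) * sum f ≤ ∑[ c < M ] (1 * (M * part c))
  total = begin
    count {M} (λ _ → true) * sum f         ≡⟨ cong (_* sum f) count-all ⟩
    M * sum f                              ≤⟨ *-monoʳ-≤ M (sum-mono-≤ covered) ⟩
    M * ∑[ x < n ] ∑[ c < M ] (ind (does (cl x ≟ toℕ c)) * f x) ≡⟨ cong (M *_) (∑-comm {n} {M} (λ x c → ind (does (cl x ≟ toℕ c)) * f x)) ⟩
    M * sum {M} part                           ≡⟨ *-distribˡ-sum M part ⟩
    ∑[ c < M ] (M * part c)                ≡⟨ sum-cong-≗ {M} (λ c → sym (*-identityˡ (M * part c))) ⟩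
    ∑[ c < M ] (1 * (M * part c))          ∎

-- The largest i ≤ N with R ^ i ≤ x; the value 0 is also taken when x = 0.
class : ℕ → ℕ → ℕ → ℕ
class R zero    x = 0
class R (suc N) x = if does (R ^ suc N ≤? x) then suc N else class R N x

class≤ : ∀ R N x → class R N x ≤ N
class≤ R zero    x = z≤n
class≤ R (suc N) x with does (R ^ suc N ≤? x)
... | true  = ≤-refl
... | false = m≤n⇒m≤1+n (class≤ R N x)

class-lower : ∀ R N x → 0 < class R N x → R ^ class R N x ≤ x
class-lower R (suc N) x pos with does (R ^ suc N ≤? x) in eq
... | true  = does-true⇒ (R ^ suc N ≤? x) eq
... | false = class-lower R N x pos

class-upper : ∀ R N x → x < R ^ suc N → x < R ^ suc (class R N x)
class-upper R zero    x x< = x<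
class-upper R (suc N) x x< with does (R ^ suc N ≤? x) in eq
... | true  = x<
... | false = class-upper R N x (≰⇒> (does-false⇒ (R ^ suc N ≤? x) eq))

^-cancelʳ-≤ : ∀ R {x y} → 1 < R → R ^ x ≤ R ^ y → x ≤ y
^-cancelʳ-≤ R {x} {y} 1<R Rx≤Ry with x ≤? y
... | yes x≤y = x≤y
... | no x≰y  = contradiction Rx≤Ry (<⇒≱ (^-monoʳ-< R 1<R (≰⇒> x≰y)))

degreeSum : Graph n → ℕ
degreeSum G = sum (degree (adj G))

-- The classes 0 to 2q number M = 2q + 1. Three pigeonholes are made, two on the degrees of the ends
-- of an edge and one on the degrees into B; each costs a factor M, and M³ ≤ R.
module Regularisation (G : Graph n) {t : ℕ} (free : ¬ Contains (SubdivK t) G) (R q : ℕ)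
  (1≤t : 1 ≤ t) (κ≤R : κ t ≤ R) (1<R : 1 < R) (M³≤R : suc (2 * q) * (suc (2 * q) * suc (2 * q)) ≤ R)
  (q-large : 13 * t + 12 ≤ q) (n≤ : n ≤ R ^ (2 * q)) (dense : R ^ (3 * q ∸ 2) ≤ degreeSum G) where

  open ≤-Reasoning

  private
    N M D : ℕ
    N = 2 * q
    M = suc N
    D = degreeSum G
    instance
      R≢0 : NonZero R
      R≢0 = >-nonZero (<-trans z<s 1<R)
    e : Fin n → Fin n → ℕ
    e u w = ind (adj G u w)
    deg cl : Fin n → ℕ
    deg = degree (adj G)
    cl u = class R N (deg u)
    In : ℕ → Fin n → Bool
    In c u = does (cl u ≟ c)

    D>0 : 0 < D
    D>0 = ≤-trans (m^n>0 R (3 * q ∸ 2)) dense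

    -- Degrees stay below R^M, so the cap in `class` is harmless and `class-upper` applies.
    count<R^M : ∀ (S : Fin n → Bool) → count S < R ^ M
    count<R^M S = ≤-<-trans (≤-trans (count≤n S) n≤) (^-monoʳ-< R 1<R (n<1+n N))

    between : ℕ → ℕ → ℕ
    between c₁ c₂ = ∑[ w < n ] (ind (In c₂ w) * ∑[ u < n ] (ind (In c₁ u) * e u w))

    between-rows : ∀ c₁ c₂ → between c₁ c₂ ≡ ∑[ u < n ] (ind (In c₁ u) * ∑[ w < n ] (ind (In c₂ w) * e u w))
    between-rows c₁ c₂ = begin-equality
      between c₁ c₂
        ≡⟨ sum-cong-≗ {n} (λ w → *-distribˡ-sum (ind (In c₂ w)) (λ u → ind (In c₁ u) * e u w)) ⟩
      ∑[ w < n ] ∑[ u < n ] (ind (In c₂ w) * (ind (In c₁ u) * e u w))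
        ≡⟨ ∑-comm (λ w u → ind (In c₂ w) * (ind (In c₁ u) * e u w)) ⟩
      ∑[ u < n ] ∑[ w < n ] (ind (In c₂ w) * (ind (In c₁ u) * e u w))
        ≡⟨ sum-cong-≗ {n} (λ u → sum-cong-≗ {n} (λ w → swap (ind (In c₂ w)) (ind (In c₁ u)) (e u w))) ⟩
      ∑[ u < n ] ∑[ w < n ] (ind (In c₁ u) * (ind (In c₂ w) * e u w))
        ≡⟨ sum-cong-≗ {n} (λ u → sym (*-distribˡ-sum (ind (In c₁ u)) (λ w → ind (In c₂ w) * e u w))) ⟩
      ∑[ u < n ] (ind (In c₁ u) * ∑[ w < n ] (ind (In c₂ w) * e u w)) ∎
      where
      swap : ∀ a b c → a * (b * c) ≡ b * (a * c)
      swap = solve-∀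

    between-sym : ∀ c₁ c₂ → between c₁ c₂ ≡ between c₂ c₁
    between-sym c₁ c₂ = trans (between-rows c₁ c₂)
      (sum-cong-≗ {n} (λ u → cong (ind (In c₁ u) *_) (sum-cong-≗ {n} (λ w →
        cong (λ b → ind (In c₂ w) * ind b) (Graph.sym G u w)))))

    -- The degrees in A are at least R^c and add up to at most D. Class 0 is excluded, since it also
    -- contains isolated vertices.
    class-size : ∀ c (A : Fin n → Bool) → 0 < c → (∀ u → A u ≡ true → cl u ≡ c) → count A * R ^ c ≤ D
    class-size c A c>0 A⊆ = ≤-trans (weighted-sum-≥ A lower) (sum-mono-≤ forget)
      where
      lower : ∀ u → A u ≡ true → R ^ c ≤ deg u
      lower u Au with refl ← A⊆ u Au = class-lower R N (deg u) c>0
      forget : ∀ u → ind (A u) * deg u ≤ deg u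
      forget u = ≤-trans (*-monoˡ-≤ (deg u) (ind≤1 (A u))) (≤-reflexive (*-identityˡ (deg u)))

    -- `B` is the lower of the two classes: this keeps its degrees small, and c ≤ c₁ later bounds c
    -- by the row exponent d.
    module Pair (c₁ c : ℕ) (c≤c₁ : c ≤ c₁) (D≤between : D ≤ M * (M * between c₁ c)) where
      B : Fin n → Bool
      B = In c
      E : Fin n → Fin n → Bool
      E u w = B w ∧ adj G u w
      b = count B

      column-degree : ∀ w → ∑[ v < n ] e v w ≡ deg w
      column-degree w = sum-cong-≗ {n} (λ v → cong ind (Graph.sym G v w))

      B-upper : ∀ w → B w ≡ true → deg w ≤ R ^ (c + 1)
      B-upper w Bw = ≤-trans (<⇒≤ (class-upper R N (deg w) (count<R^M (adj G w))))
        (≤-reflexive (cong (R ^_) (trans (cong suc (does-true⇒ (cl w ≟ c) Bw)) (+-comm 1 c))))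

      columns : ∀ w → ∑[ v < n ] ind (E v w) ≤ R ^ (c + 1)
      columns w with B w in eq
      ... | true  = ≤-trans (≤-reflexive (column-degree w)) (B-upper w eq)
      ... | false = ≤-trans (≤-reflexive (sum-replicate-zero n)) z≤n

      between≤ : between c₁ c ≤ b * R ^ (c + 1)
      between≤ = weighted-sum-≤ B (λ w Bw → ≤-trans (sum-mono-≤ (λ u →
          ≤-trans (*-monoˡ-≤ (e u w) (ind≤1 (In c₁ u))) (≤-reflexive (*-identityˡ (e u w)))))
        (≤-trans (≤-reflexive (column-degree w)) (B-upper w Bw)))

      M²≤R : M * M ≤ R
      M²≤R = ≤-trans (m≤n*m (M * M) M) M³≤R

      D≤bR : D ≤ R * (b * R ^ (c + 1))
      D≤bR = begin
        D                              ≤⟨ D≤between ⟩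
        M * (M * between c₁ c)         ≡⟨ sym (*-assoc M M (between c₁ c)) ⟩
        M * M * between c₁ c           ≤⟨ *-mono-≤ M²≤R between≤ ⟩
        R * (b * R ^ (c + 1))          ∎

      b>0 : 0 < b
      b>0 = n≢0⇒n>0 λ b≡0 → contradiction D>0 (≤⇒≯ (≤-trans D≤bR
        (≤-reflexive (trans (cong (λ z → R * (z * R ^ (c + 1))) b≡0) (*-zeroʳ R)))))

      -- Since b ≤ n ≤ R^(2q), comparing the exponents in R^(3q-2) ≤ D ≤ R · b · R^(c+1) gives 3q -
      -- 2 ≤ 2q + c + 2.
      q≤c+4 : q ≤ c + 4
      q≤c+4 = +-cancelˡ-≤ (2 * q) q (c + 4) (begin
        2 * q + q                 ≡⟨ +-comm (2 * q) q ⟩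
        3 * q                     ≤⟨ m≤n+m∸n (3 * q) 2 ⟩
        2 + (3 * q ∸ 2)           ≤⟨ +-monoʳ-≤ 2 (^-cancelʳ-≤ R 1<R powers) ⟩
        2 + suc (2 * q + (c + 1)) ≡⟨ shape (2 * q) c ⟩
        2 * q + (c + 4)           ∎)
        where
        powers : R ^ (3 * q ∸ 2) ≤ R ^ suc (2 * q + (c + 1))
        powers = begin
          R ^ (3 * q ∸ 2)                ≤⟨ dense ⟩
          D                              ≤⟨ D≤bR ⟩
          R * (b * R ^ (c + 1))          ≤⟨ *-monoʳ-≤ R (*-monoˡ-≤ (R ^ (c + 1)) (≤-trans (count≤n B) n≤)) ⟩
          R * (R ^ (2 * q) * R ^ (c + 1)) ≡⟨ cong (R *_) (sym (^-distribˡ-+-* R (2 * q) (c + 1))) ⟩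
          R ^ suc (2 * q + (c + 1))      ∎
        shape : ∀ x c → 2 + suc (x + (c + 1)) ≡ x + (c + 4)
        shape = solve-∀

      c-large : 13 * t + 8 ≤ c
      c-large = +-cancelʳ-≤ 4 (13 * t + 8) c (begin
        13 * t + 8 + 4   ≡⟨ +-assoc (13 * t) 8 4 ⟩
        13 * t + 12      ≤⟨ q-large ⟩
        q                ≤⟨ q≤c+4 ⟩
        c + 4            ∎)

      c>0 : 0 < c
      c>0 = ≤-trans (≤-trans (s≤s z≤n) (m≤n+m 8 (13 * t))) c-large

      r rcl : Fin n → ℕ
      r = degree E
      rcl u = class R N (r u)

      module RowClass (d : ℕ)
        (between≤rows : between c₁ c ≤ M * ∑[ u < n ] (ind (does (rcl u ≟ d)) * (ind (In c₁ u) * r u))) where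
        A : Fin n → Bool
        A u = does (rcl u ≟ d) ∧ In c₁ u
        a = count A

        rows-upper : ∑[ u < n ] (ind (does (rcl u ≟ d)) * (ind (In c₁ u) * r u)) ≤ a * R ^ suc d
        rows-upper = begin
          ∑[ u < n ] (ind (does (rcl u ≟ d)) * (ind (In c₁ u) * r u))
            ≡⟨ sum-cong-≗ {n} (λ u → trans (sym (*-assoc (ind (does (rcl u ≟ d))) (ind (In c₁ u)) (r u)))
                 (cong (_* r u) (sym (ind-∧ (does (rcl u ≟ d)) (In c₁ u))))) ⟩
          ∑[ u < n ] (ind (A u) * r u)
            ≤⟨ weighted-sum-≤ A (λ u Au → ≤-trans (<⇒≤ (class-upper R N (r u) (count<R^M (E u))))
                 (≤-reflexive (cong (λ z → R ^ suc z) (does-true⇒ (rcl u ≟ d) (∧-trueˡ _ Au))))) ⟩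
          a * R ^ suc d ∎

        D≤aR : D ≤ a * R ^ (d + 2)
        D≤aR = begin
          D                              ≤⟨ D≤between ⟩
          M * (M * between c₁ c)         ≤⟨ *-monoʳ-≤ M (*-monoʳ-≤ M (≤-trans between≤rows (*-monoʳ-≤ M rows-upper))) ⟩
          M * (M * (M * (a * R ^ suc d))) ≡⟨ shape₁ M a (R ^ suc d) ⟩
          M * (M * M) * (a * R ^ suc d)  ≤⟨ *-monoˡ-≤ (a * R ^ suc d) M³≤R ⟩
          R * (a * R ^ suc d)            ≡⟨ shape₂ R a (R ^ suc d) ⟩
          a * R ^ suc (suc d)            ≡⟨ cong (λ z → a * R ^ z) (+-comm 2 d) ⟩
          a * R ^ (d + 2)                ∎
          where
          shape₁ : ∀ M a x → M * (M * (M * (a * x))) ≡ M * (M * M) * (a * x)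
          shape₁ = solve-∀
          shape₂ : ∀ R a x → R * (a * x) ≡ a * (R * x)
          shape₂ = solve-∀

        a>0 : 0 < a
        a>0 = n≢0⇒n>0 λ a≡0 → contradiction D>0 (≤⇒≯ (≤-trans D≤aR (≤-reflexive (cong (_* R ^ (d + 2)) a≡0))))

        -- Vertices of A have degree at least R^(c₁) in G, so a R^(c₁) ≤ D ≤ a R^(d+2).
        c≤d+2 : c ≤ d + 2
        c≤d+2 = ≤-trans c≤c₁ (^-cancelʳ-≤ R 1<R (*-cancelˡ-≤ a {{>-nonZero a>0}} (≤-trans
          (class-size c₁ A (≤-trans c>0 c≤c₁) (λ u Au → does-true⇒ (cl u ≟ c₁) (∧-trueʳ (does (rcl u ≟ d)) Au))) D≤aR)))

        d-large : 13 * t + 6 ≤ d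
        d-large = +-cancelʳ-≤ 2 (13 * t + 6) d (begin
          13 * t + 6 + 2   ≡⟨ +-assoc (13 * t) 6 2 ⟩
          13 * t + 8       ≤⟨ c-large ⟩
          c                ≤⟨ c≤d+2 ⟩
          d + 2            ∎)

        -- The 12 comes from q ≤ c + 4 and c ≤ d + 2, doubled.
        b-small : b ≤ R ^ (2 * d + 12)
        b-small = ≤-trans (≤-trans (count≤n B) n≤) (^-monoʳ-≤ R (begin
          2 * q            ≤⟨ *-monoʳ-≤ 2 (≤-trans q≤c+4 (+-monoˡ-≤ 4 c≤d+2)) ⟩
          2 * (d + 2 + 4)  ≡⟨ shape d ⟩
          2 * d + 12       ∎))
          where
          shape : ∀ d → 2 * (d + 2 + 4) ≡ 2 * d + 12
          shape = solve-∀

        rows-lower : ∀ u → A u ≡ true → R ^ d ≤ r u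
        rows-lower u Au with eq ← does-true⇒ (rcl u ≟ d) (∧-trueˡ _ Au) =
          subst (λ z → R ^ z ≤ r u) eq (class-lower R N (r u)
            (subst (0 <_) (sym eq) (≤-trans (≤-trans (s≤s z≤n) (m≤n+m 6 (13 * t))) d-large)))

        absurd : ⊥
        absurd = almost-regular-pair⇒subdivision G E A B R c d 1≤t κ≤R
          (≤-trans (+-monoʳ-≤ (13 * t) (m≤m+n 3 5)) c-large) d-large
          (λ u w → ∧-trueʳ (B w)) (λ u w → ∧-trueˡ (B w)) rows-lower columns b>0 b-small
          -- The sizes of A and B are compared through D: b R^c ≤ D ≤ a R^(d+2).
          (≤-trans (class-size c B c>0 (λ u → does-true⇒ (cl u ≟ c))) D≤aR) free

      absurd : ⊥
      absurd with d , large ← pigeonhole M rcl (λ u → s≤s (class≤ R N (r u))) z<s (λ u → ind (In c₁ u) * r u) =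
        RowClass.absurd d (≤-trans (≤-reflexive (trans (between-rows c₁ c) (sum-cong-≗ {n} (λ u →
          cong (ind (In c₁ u) *_) (sum-cong-≗ {n} (λ w → sym (ind-∧ (B w) (adj G u w)))))))) large)

  subdivision-free⇒not-dense : ⊥
  subdivision-free⇒not-dense
    with c₁ , D≤ ← pigeonhole M cl (λ u → s≤s (class≤ R N (deg u))) z<s deg
    with c₂ , D₁≤ ← pigeonhole M cl (λ u → s≤s (class≤ R N (deg u))) z<s (λ w → ∑[ u < n ] (ind (In c₁ u) * e u w))
    = orient (≤-total c₂ c₁)
    where
    D≤between : D ≤ M * (M * between c₁ c₂)
    D≤between = ≤-trans D≤ (*-monoʳ-≤ M (≤-trans (≤-reflexive exchange) D₁≤))
      where
      exchange : ∑[ u < n ] (ind (In c₁ u) * deg u) ≡ ∑[ w < n ] ∑[ u < n ] (ind (In c₁ u) * e u w)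
      exchange = trans (sum-cong-≗ {n} (λ u → *-distribˡ-sum (ind (In c₁ u)) (e u)))
                       (∑-comm (λ u w → ind (In c₁ u) * e u w))
    -- Edges between two classes can be counted from either side, so the lower class may serve as
    -- `B`.
    orient : c₂ ≤ c₁ ⊎ c₁ ≤ c₂ → ⊥
    orient (inj₁ c₂≤c₁) = Pair.absurd c₁ c₂ c₂≤c₁ D≤between
    orient (inj₂ c₁≤c₂) = Pair.absurd c₂ c₁ c₁≤c₂ (subst (λ z → D ≤ M * (M * z)) (between-sym c₁ c₂) D≤between)

-- The bound

list-sum≡sum : ∀ (f : Fin n → ℕ) → List.sum (List.map f (List.allFin n)) ≡ sum f
list-sum≡sum f = trans (cong List.sum (List.map-tabulate (λ i → i) f)) (sum-tabulate f)
  where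
  sum-tabulate : ∀ {n} (f : Fin n → ℕ) → List.sum (List.tabulate f) ≡ sum f
  sum-tabulate {zero}  f = refl
  sum-tabulate {suc n} f = cong (f zero +_) (sum-tabulate (f ∘ suc))

edges≤degreeSum : (G : Graph n) → edges G ≤ degreeSum G
edges≤degreeSum {n} G = begin
  edges G
    ≡⟨ list-sum≡sum (λ i → List.sum (List.map (half i) (List.allFin n))) ⟩
  ∑[ i < n ] List.sum (List.map (half i) (List.allFin n))
    ≡⟨ sum-cong-≗ {n} (λ i → list-sum≡sum (half i)) ⟩
  ∑[ i < n ] sum (half i)
    ≤⟨ sum-mono-≤ (λ i → sum-mono-≤ (λ j → half≤ (toℕ i <ᵇ toℕ j) (adj G i j))) ⟩
  degreeSum G ∎
  where
  open ≤-Reasoning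
  half : Fin n → Fin n → ℕ
  half i j = if ((toℕ i <ᵇ toℕ j) ∧ adj G i j) then 1 else 0
  half≤ : ∀ a b → (if a ∧ b then 1 else 0) ≤ ind b
  half≤ false b     = z≤n
  half≤ true  false = z≤n
  half≤ true  true  = ≤-refl

degreeSum≤n² : (G : Graph n) → degreeSum G ≤ n * n
degreeSum≤n² G = sum-≤-const (λ u → count≤n (adj G u))

^-distribʳ-* : ∀ k m n → (m * n) ^ k ≡ m ^ k * n ^ k
^-distribʳ-* zero    m n = refl
^-distribʳ-* (suc k) m n = trans (cong (m * n *_) (^-distribʳ-* k m n)) (interchange m n (m ^ k) (n ^ k))
  where
  interchange : ∀ a b c d → a * b * (c * d) ≡ a * c * (b * d)
  interchange = solve-∀

integer-root : ∀ k .{{_ : NonZero k}} n → ∃[ s ] s ^ k ≤ n × n < suc s ^ k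
integer-root k@(suc _) zero = 0 , z≤n , m^n>0 1 k
integer-root k (suc n) with s , s^k≤n , n<[1+s]^k ← integer-root k n with suc s ^ k ≤? suc n
-- Raising n by one raises the root by at most one: n + 1 ≤ (s + 1)^k < (s + 2)^k.
... | yes ≤n = suc s , ≤n , ≤-<-trans n<[1+s]^k (^-monoˡ-< k (n<1+n (suc s)))
... | no  ≰n = s , m≤n⇒m≤1+n s^k≤n , ≰⇒> ≰n

-- This supplies the room in q for t steps costing R^13 each. At t = 3 it reads 51 ≤ 216; after that
-- the left side gains 13 per step, while the right side more than doubles.
13t+12≤6^t : ∀ {t} → 3 ≤ t → 13 * t + 12 ≤ 6 ^ t
13t+12≤6^t 3≤t with s , refl ← m≤n⇒∃[o]m+o≡n 3≤t = from-three s
  where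
  open ≤-Reasoning
  from-three : ∀ s → 13 * (3 + s) + 12 ≤ 6 ^ (3 + s)
  from-three zero    = m≤m+n 51 165
  from-three (suc s) = begin
    13 * (4 + s) + 12                    ≡⟨ shape s ⟩
    13 + (13 * (3 + s) + 12)             ≤⟨ +-mono-≤ (≤-trans (m≤m+n 13 38) (≤-trans (m≤m+n 51 (13 * s)) (≤-reflexive (shape′ s)))) ≤-refl ⟩
    13 * (3 + s) + 12 + (13 * (3 + s) + 12) ≤⟨ +-mono-≤ (from-three s) (from-three s) ⟩
    6 ^ (3 + s) + 6 ^ (3 + s)            ≡⟨ cong (6 ^ (3 + s) +_) (sym (+-identityʳ _)) ⟩
    2 * 6 ^ (3 + s)                      ≤⟨ *-monoˡ-≤ (6 ^ (3 + s)) (m≤m+n 2 4) ⟩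
    6 ^ (4 + s)                          ∎
    where
    shape : ∀ s → 13 * (4 + s) + 12 ≡ 13 + (13 * (3 + s) + 12)
    shape = solve-∀
    shape′ : ∀ s → 51 + 13 * s ≡ 13 * (3 + s) + 12
    shape′ = solve-∀

-- With q = 6^t the exponent 3/2 - 1/q is (3q - 2)/(2q); raising both sides to the power 2q states
-- the bound in natural numbers.
theorem5p1 : ∀ (t : ℕ) → 3 ≤ t →
    ∃[ C ] ∀ (n : ℕ) (G : Graph n) → ¬ Contains (SubdivK t) G →
    edges G ^ (2 * 6 ^ t) ≤ C ^ (2 * 6 ^ t) * n ^ (3 * 6 ^ t ∸ 2)
theorem5p1 t 3≤t = C , bound
  where
  open ≤-Reasoning
  q p M K C : ℕ
  q = 6 ^ t
  p = 3 * q ∸ 2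
  M = suc (2 * q)
  -- `K` exceeds each lower bound required of R. In `C`, the factor K^(q+2) forces R ≥ K, and 2^p
  -- pays for rounding the root s up to R = s + 1 ≤ 2s.
  K = 2 + (κ t + M * (M * M))
  C = K ^ (q + 2) * 2 ^ p

  q-large : 13 * t + 12 ≤ q
  q-large = 13t+12≤6^t 3≤t

  instance
    q≢0 : NonZero q
    q≢0 = m^n≢0 6 t
    2q≢0 : NonZero (2 * q)
    2q≢0 = m*n≢0 2 q

  exponents : p + (q + 2) ≡ 2 * q + 2 * q
  exponents = begin-equality
    p + (q + 2)       ≡⟨ shape₁ p q ⟩
    p + 2 + q         ≡⟨ cong (_+ q) (m∸n+n≡m {3 * q} {2} (≤-trans (m≤m+n 2 1) (m≤m*n 3 q))) ⟩
    3 * q + q         ≡⟨ shape₂ q ⟩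
    2 * q + 2 * q     ∎
    where
    shape₁ : ∀ p q → p + (q + 2) ≡ p + 2 + q
    shape₁ = solve-∀
    shape₂ : ∀ q → 3 * q + q ≡ 2 * q + 2 * q
    shape₂ = solve-∀

  module _ (n : ℕ) (G : Graph n) (free : ¬ Contains (SubdivK t) G)
           (many : C ^ (2 * q) * n ^ p < edges G ^ (2 * q)) where

    e≤D : edges G ≤ degreeSum G
    e≤D = edges≤degreeSum G

    impossible : ∃[ s ] s ^ (2 * q) ≤ n × n < suc s ^ (2 * q) → ⊥
    impossible (s , s^2q≤n , n<) =
      Regularisation.subdivision-free⇒not-dense G free R q (≤-trans (m≤m+n 1 2) 3≤t)
        (≤-trans (≤-trans (m≤m+n (κ t) _) (m≤n+m _ 2)) K≤R)
        (≤-trans (m≤m+n 2 _) K≤R)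
        (≤-trans (≤-trans (m≤n+m _ (κ t)) (m≤n+m _ 2)) K≤R)
        q-large (<⇒≤ n<)
        (≤-trans (≤-trans (m≤n*m (R ^ p) (K ^ (q + 2)) {{m^n≢0 K (q + 2)}}) (<⇒≤ KR<e)) e≤D)
      where
      R : ℕ
      R = suc s

      -- Taking the 2q-th root of the assumption `many`, with s^(2q) in place of n.
      Cs^p<e : C * s ^ p < edges G
      Cs^p<e = ≰⇒> λ e≤Cs^p → <⇒≱ many (begin
        edges G ^ (2 * q)               ≤⟨ ^-monoˡ-≤ (2 * q) e≤Cs^p ⟩
        (C * s ^ p) ^ (2 * q)           ≡⟨ ^-distribʳ-* (2 * q) C (s ^ p) ⟩
        C ^ (2 * q) * (s ^ p) ^ (2 * q) ≡⟨ cong (C ^ (2 * q) *_) (trans (^-*-assoc s p (2 * q))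
                                             (trans (cong (s ^_) (*-comm p (2 * q))) (sym (^-*-assoc s (2 * q) p)))) ⟩
        C ^ (2 * q) * (s ^ (2 * q)) ^ p ≤⟨ *-monoʳ-≤ (C ^ (2 * q)) (^-monoˡ-≤ p s^2q≤n) ⟩
        C ^ (2 * q) * n ^ p             ∎)

      -- A root s = 0 would mean n = 0, hence no edges.
      s>0 : 0 < s
      s>0 = n≢0⇒n>0 λ s≡0 →
        let n≡0 : n ≡ 0
            n≡0 = n<1⇒n≡0 (≤-trans n< (≤-reflexive (trans (cong (λ z → suc z ^ (2 * q)) s≡0) (^-zeroˡ (2 * q)))))
        in <⇒≱ Cs^p<e (≤-trans e≤D (≤-trans (degreeSum≤n² G) (≤-trans (≤-reflexive (cong (λ z → z * n) n≡0)) z≤n)))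

      R≤2s : R ≤ 2 * s
      R≤2s = ≤-trans (+-monoˡ-≤ s s>0) (≤-reflexive (cong (s +_) (sym (+-identityʳ s))))

      KR<e : K ^ (q + 2) * R ^ p < edges G
      KR<e = begin-strict
        K ^ (q + 2) * R ^ p             ≤⟨ *-monoʳ-≤ (K ^ (q + 2)) (^-monoˡ-≤ p R≤2s) ⟩
        K ^ (q + 2) * (2 * s) ^ p       ≡⟨ cong (K ^ (q + 2) *_) (^-distribʳ-* p 2 s) ⟩
        K ^ (q + 2) * (2 ^ p * s ^ p)   ≡⟨ sym (*-assoc (K ^ (q + 2)) (2 ^ p) (s ^ p)) ⟩
        C * s ^ p                       <⟨ Cs^p<e ⟩
        edges G                         ∎

      -- Otherwise C n^(3/2 - 1/q) would already exceed n².
      K≤R : K ≤ R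
      K≤R = ≮⇒≥ λ R<K → <⇒≱ KR<e (begin
        edges G                        ≤⟨ e≤D ⟩
        degreeSum G                    ≤⟨ degreeSum≤n² G ⟩
        n * n                          ≤⟨ *-mono-≤ (<⇒≤ n<) (<⇒≤ n<) ⟩
        R ^ (2 * q) * R ^ (2 * q)      ≡⟨ sym (^-distribˡ-+-* R (2 * q) (2 * q)) ⟩
        R ^ (2 * q + 2 * q)            ≡⟨ ^-split R p (q + 2) (sym exponents) ⟩
        R ^ p * R ^ (q + 2)            ≤⟨ *-monoʳ-≤ (R ^ p) (^-monoˡ-≤ (q + 2) (<⇒≤ R<K)) ⟩
        R ^ p * K ^ (q + 2)            ≡⟨ *-comm (R ^ p) (K ^ (q + 2)) ⟩
        K ^ (q + 2) * R ^ p            ∎)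

  bound : ∀ n (G : Graph n) → ¬ Contains (SubdivK t) G →
          edges G ^ (2 * q) ≤ C ^ (2 * q) * n ^ p
  bound n G free = ≮⇒≥ λ many → impossible n G free many (integer-root (2 * q) n)
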